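{- For every digraph $F\in\mathscr{F}$, $\mathrm{mader}_{\overrightarrow{\chi}}(F)=|V(F)|$. (Consequently every digraph in $\mathscr{F}$ is Mader-perfect, since $\mathscr{F}$ is closed under taking subdigraphs.)
   Context: All digraphs are finite. $(u,v)$ denotes an arc with tail $u$ and head $v$. An acyclic $k$-coloring of a digraph $D$ is a map $c:V(D)\to\{1,\ldots,k\}$ such that each color class induces a subdigraph with no directed cycle; the dichromatic number $\overrightarrow{\chi}(D)$ is the least $k$ for which such a coloring exists. A subdivision of a digraph $H$ is obtained by replacing each arc $(u,v)$ of $H$ by a directed path from $u$ to $v$, the paths being internally vertex-disjoint from each other and from $V(H)$. $\mathrm{mader}_{\overrightarrow{\chi}}(H)$ is the smallest integer $m$ such that every digraph $D$ with $\overrightarrow{\chi}(D)\ge m$ contains a subdivision of $H$. A digraph $F$ is Mader-perfect if $\mathrm{mader}_{\overrightarrow{\chi}}(F')=|V(F')|$ for every subdigraph $F'$ of $F$. For a graph $G$, $\overleftrightarrow{G}$ is obtained by replacing each edge $uv$ by the arcs $(u,v)$ and $(v,u)$ (a digon). For the path $P_k=v_1\ldots v_k$, a subdigraph $Q$ of $\overleftrightarrow{P_k}$ is good if (a) $Q$ is connected, $|V(Q)|=k$, and all digons of $Q$ are pairwise vertex-disjoint; (b) $d^+_Q(v_1)+d^-_Q(v_1)=1$; $\mathscr{S}_k$ is the set of good subdigraphs of $\overleftrightarrow{P_k}$. The family $\mathscr{F}$ is defined recursively: (i) $K_1\in\mathscr{F}$; (ii) if $F\in\mathscr{F}$, $v_0\in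 V(F)$ and $Q\in\mathscr{S}_k$ ($k\ge1$) on new vertices $v_1,\ldots,v_k$ disjoint from $V(F)$, then the digraph obtained from $F$ by adding $Q$, both arcs $(v_0,v_1),(v_1,v_0)$, and (if $k\ge2$) exactly one of the arcs $(v_0,v_k),(v_k,v_0)$ is in $\mathscr{F}$; (iii) every subdigraph of a digraph in $\mathscr{F}$ is in $\mathscr{F}$. -}

module Defs where

open import Data.Nat using (ℕ; zero; suc; _≤_; _<_; _+_)
open import Data.Fin using (Fin; zero; suc; toℕ; fromℕ; splitAt)
open import Data.Fin.Properties using () renaming (_≟_ to _≟ᶠ_)
open import Data.Bool using (Bool; true; false; T; _∧_; _∨_; not; if_then_else_)
open import Data.List using (List; []; _∷_; _∷ʳ_; allFin; map; last)
open import Data.Nat.ListAction using (sum)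
open import Data.Empty using (⊥)
open import Data.List.Relation.Unary.All using (All)
open import Data.List.Relation.Unary.Linked using (Linked)
open import Data.List.Relation.Unary.Unique.Propositional using (Unique)
open import Data.List.Membership.Propositional using (_∈_; _∉_)
open import Data.Maybe using (just)
open import Data.Product using (Σ; ∃; ∃-syntax; _×_; _,_)
open import Data.Sum using (_⊎_; inj₁; inj₂)
open import Relation.Nullary using (¬_; does)
open import Relation.Binary.PropositionalEquality using (_≡_; _≢_)
open import Function.Definitions using (Injective)

-- Digraphs on vertex set Fin n; arc u v = true  iff  (u,v) is an arc.
-- (No parallel arcs; loops are representable but excluded where needed.)

record Digraph (n : ℕ) : Set where
  constructor mkDigraph
  field
    arc : Fin n → Fin n → Bool

open Digraph public

Arc : ∀ {n} → Digraph n → Fin n → Fin n → Set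
Arc D u v = T (arc D u v)

Loopless : ∀ {n} → Digraph n → Set
Loopless D = ∀ v → ¬ Arc D v v

-- The list  x ∷ xs  of pairwise distinct vertices is a directed cycle
-- x → x₁ → … → x_m → x  (a loop if xs = []).
IsDirectedCycle : ∀ {n} → Digraph n → List (Fin n) → Set
IsDirectedCycle D []       = ⊥
IsDirectedCycle D (x ∷ xs) =
  Linked (Arc D) (x ∷ xs ∷ʳ x) × Unique (x ∷ xs)

IsAcyclicColouring : ∀ {n} → Digraph n → (k : ℕ) → (Fin n → Fin k) → Set
IsAcyclicColouring D k c =
  ∀ x xs → IsDirectedCycle D (x ∷ xs) → ¬ All (λ y → c y ≡ c x) xs

AcyclicallyColourable : ∀ {n} → Digraph n → ℕ → Set
AcyclicallyColourable {n} D k = Σ (Fin n → Fin k) (IsAcyclicColouring D k)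

DichromaticAtLeast : ∀ {n} → Digraph n → ℕ → Set
DichromaticAtLeast D m = ∀ k → k < m → ¬ AcyclicallyColourable D k

-- D contains a subdivision of H: branch vertices φ (injective), and for each
-- arc (u,v) of H a directed path  φ u, P u v e, φ v  in D (internal vertices
-- P u v e), internally disjoint from each other and from φ(V(H)).
ContainsSubdivision : ∀ {h n} → Digraph h → Digraph n → Set
ContainsSubdivision {h} {n} H D =
  Σ (Fin h → Fin n) λ φ →
  Injective _≡_ _≡_ φ ×
  Σ ((u v : Fin h) → Arc H u v → List (Fin n)) λ P →
    (∀ u v e → Linked (Arc D) (φ u ∷ P u v e ∷ʳ φ v)) ×
    (∀ u v e → Unique (P u v e)) ×
    (∀ u v e w → φ w ∉ P u v e) ×
    (∀ u v e u′ v′ e′ → ¬ (u ≡ u′ × v ≡ v′) →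
        ∀ x → x ∈ P u v e → x ∉ P u′ v′ e′)

MaderBound : ∀ {h} → Digraph h → ℕ → Set
MaderBound H m =
  ∀ {n} (D : Digraph n) → Loopless D → DichromaticAtLeast D m →
  ContainsSubdivision H D

MaderIs : ∀ {h} → Digraph h → ℕ → Set
MaderIs H m = MaderBound H m × (∀ m′ → MaderBound H m′ → m ≤ m′)

SubdigraphOf : ∀ {m n} → Digraph m → Digraph n → Set
SubdigraphOf {m} {n} F′ F =
  Σ (Fin m → Fin n) λ f →
    Injective _≡_ _≡_ f × (∀ u v → Arc F′ u v → Arc F (f u) (f v))

-- Good subdigraphs of the bidirected path ↔P_k, k = suc k′,
-- vertices v₁,…,v_k  ↔  0,…,k′.

Adjacent : ∀ {n} → Digraph n → Fin n → Fin n → Set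
Adjacent D a b = Arc D a b ⊎ Arc D b a

WeaklyConnected : ∀ {n} → Digraph n → Set
WeaklyConnected D =
  ∀ u v → ∃[ xs ] (Linked (Adjacent D) (u ∷ xs) × last (u ∷ xs) ≡ just v)

indicator : Bool → ℕ
indicator true  = 1
indicator false = 0

outdeg indeg : ∀ {n} → Digraph n → Fin n → ℕ
outdeg {n} D v = sum (map (λ w → indicator (arc D v w)) (allFin n))
indeg  {n} D v = sum (map (λ w → indicator (arc D w v)) (allFin n))

record Good {k′ : ℕ} (Q : Digraph (suc k′)) : Set where
  field
    -- Q is a (spanning) subdigraph of ↔P_k
    pathArcs  : ∀ i j → Arc Q i j → toℕ j ≡ suc (toℕ i) ⊎ toℕ i ≡ suc (toℕ j)
    connected : WeaklyConnected Q
    digonsDisjoint : ∀ a b c → Arc Q a b → Arc Q b a → Arc Q b c → Arc Q c b → a ≡ c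
    degFirst  : 2 ≤ suc k′ → outdeg Q zero + indeg Q zero ≡ 1

K₁ : Digraph 1
K₁ = mkDigraph (λ _ _ → false)

_==_ : ∀ {n} → Fin n → Fin n → Bool
a == b = does (a ≟ᶠ b)

-- Attach Q (vertices n, …, n+k′ = v₁,…,v_k) to F at v₀: digon v₀v₁ and,
-- if k ≥ 2, the arc (v₀,v_k) when dir = true, resp. (v_k,v₀) when dir = false.
extend : ∀ {n k′} → Digraph n → Fin n → Digraph (suc k′) → Bool → Digraph (n + suc k′)
extend {n} {k′} F v₀ Q dir = mkDigraph λ x y → go (splitAt n x) (splitAt n y)
  where
  go : Fin n ⊎ Fin (suc k′) → Fin n ⊎ Fin (suc k′) → Bool
  go (inj₁ a) (inj₁ b) = arc F a b
  go (inj₂ i) (inj₂ j) = arc Q i j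
  go (inj₁ a) (inj₂ j) = (a == v₀) ∧ ((j == zero) ∨ ((j == fromℕ k′) ∧ dir))
  go (inj₂ i) (inj₁ b) = (b == v₀) ∧ ((i == zero) ∨ ((i == fromℕ k′) ∧ not dir))

data 𝓕 : ∀ {n} → Digraph n → Set where
  base : 𝓕 K₁
  step : ∀ {n k′} {F : Digraph n} → 𝓕 F → (v₀ : Fin n) →
         (Q : Digraph (suc k′)) → Good Q → (dir : Bool) →
         𝓕 (extend F v₀ Q dir)
  sub  : ∀ {m n} {F′ : Digraph m} {F : Digraph n} →
         𝓕 F → SubdigraphOf F′ F → 𝓕 F′

{-# OPTIONS --safe #-}
module Submission where

-- The lower bound is the complete digraph. For the upper bound one shows, for all
-- vertex subsets p of a digraph in 𝓕 at once, that |p| colours force the part on p.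
-- If p misses v₀ or a new vertex, the new vertices in p are added one at a time, each
-- with at most one earlier neighbour: removing a maximal acyclic set X costs one
-- colour, and every vertex outside X closes a directed cycle with X.
--
-- Otherwise let X be a maximal k-coloured set and x ∉ X the image of v₀ in a subdivision
-- of the rest; the ear is found in X ∪ {x}. Try to colour x as well: give x colour 1,
-- let the vertices of colour 1 that now lie on monochromatic cycles move to colour 2,
-- and so on cyclically (from colour k back to 1). Every moved vertex lies on a cycle
-- with vertices moved before, so it is joined to them by paths in both directions.
-- Hence one can walk from a vertex of colour k back to x with each of the k final links
-- in any prescribed direction, and the links before them all in the direction of
-- v₁v₂, so that they merge into one. A digon link uses a whole cycle, which occupies
-- two consecutive colours; this is why the digons of Q must be disjoint. By maximality
-- some monochromatic cycle through x and a moved vertex of colour k must appear, and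
-- it is the digon v₀v₁.

open import Defs
open import Data.Nat using (ℕ; zero; suc; _≤_; _<_; _+_; _∸_; z≤n; s≤s; _≤?_; _<?_; s≤s⁻¹; pred)
import Data.Nat as ℕ
import Data.Nat.Properties as ℕₚ
open import Data.Fin using (Fin; zero; suc; toℕ; fromℕ; fromℕ<; splitAt; _↑ˡ_; _↑ʳ_)
open import Data.Fin.Properties using (_≟_; any?; injective⇒≤; toℕ<n; toℕ-fromℕ<; toℕ-fromℕ; toℕ-injective; splitAt-↑ˡ; splitAt-↑ʳ; join-splitAt; pigeonhole)
open import Data.Bool using (Bool; true; false; T; _∧_; _∨_; not; if_then_else_)
open import Data.Bool.Properties using (T?; T-∨)
open import Data.Nat.ListAction using (sum)
import Data.List as List
open import Data.List using (List; []; _∷_; _∷ʳ_; _++_; allFin; length; lookup; reverse)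
open import Data.List.Properties using (unfold-reverse)
open import Data.List.Relation.Unary.All as All using (All; []; _∷_)
open import Data.List.Relation.Unary.Any as Any using (here; there)
open import Data.List.Relation.Unary.Any.Properties using (reverse⁻)
open import Data.List.Relation.Unary.AllPairs using ([]; _∷_)
open import Data.List.Relation.Unary.Linked using (Linked; [-]; _∷_; linked?)
open import Data.List.Relation.Unary.Unique.Propositional using (Unique)
open import Data.List.Relation.Unary.Unique.Propositional.Properties using (++⁺; Unique[x∷xs]⇒x∉xs)
open import Data.List.Membership.Propositional using (_∈_; _∉_; find)
open import Data.List.Membership.Propositional.Properties using (∈-++⁺ˡ; ∈-++⁺ʳ; ∈-++⁻; ∈-∃++; ∈-lookup; ∈-allFin)
open import Data.List.Relation.Binary.Permutation.Propositional using (_↭_; ↭-sym; ↭-trans; ↭-prep; ↭⇒↭ₛ)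
open import Data.List.Relation.Binary.Permutation.Propositional.Properties using (↭-reverse; ++-comm; shift; ∈-resp-↭)
import Data.List.Relation.Binary.Permutation.Setoid.Properties as Permₛ
open import Data.Product using (Σ; ∃; ∃-syntax; _×_; _,_; proj₁; proj₂)
open import Data.Sum using (_⊎_; inj₁; inj₂; [_,_]′)
open import Data.Empty using (⊥; ⊥-elim)
open import Data.Unit using (tt)
open import Function using (_∘_; id; flip; case_of_)
open import Function.Bundles using (Equivalence)
open import Relation.Nullary using (¬_; Dec; yes; no; does; contradiction; decidable-stable; map′; ¬?; _×-dec_; _⊎-dec_)
open import Relation.Unary using (Decidable)
open import Relation.Binary.PropositionalEquality using (_≡_; _≢_; refl; sym; trans; cong; cong₂; subst; setoid)
import Data.List.Relation.Unary.Unique.DecPropositional as DecUnique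

-- Lists, subsets and paths

private
  variable
    A : Set
    n : ℕ
    x y z u v w : A
    xs ys I J : List A

Unique-resp-↭ : ∀ {A : Set} {xs ys : List A} → xs ↭ ys → Unique xs → Unique ys
Unique-resp-↭ {A = A} p = Permₛ.Unique-resp-↭ (setoid A) (↭⇒↭ₛ p)

Unique-∷⁺ : x ∉ xs → Unique xs → Unique (x ∷ xs)
Unique-∷⁺ x∉xs u = All.tabulate (λ y∈xs x≡y → x∉xs (subst (_∈ _) (sym x≡y) y∈xs)) ∷ u

Unique-∷⁻ : Unique (x ∷ xs) → x ∉ xs × Unique xs
Unique-∷⁻ u@(_ ∷ u′) = Unique[x∷xs]⇒x∉xs u , u′

Unique-++⁻ : ∀ (xs : List A) → Unique (xs ++ ys) →
             Unique xs × Unique ys × (∀ {z} → z ∈ xs → z ∉ ys)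
Unique-++⁻ []       u = [] , u , λ ()
Unique-++⁻ (x ∷ xs) u with Unique-∷⁻ u
... | x∉ , u′ with Unique-++⁻ xs u′
... | uxs , uys , dis = Unique-∷⁺ (x∉ ∘ ∈-++⁺ˡ) uxs , uys ,
      λ { (here refl) → x∉ ∘ ∈-++⁺ʳ xs ; (there z∈) → dis z∈ }

lookup-injective : (xs : List A) → Unique xs → ∀ {i j} → lookup xs i ≡ lookup xs j → i ≡ j
lookup-injective (x ∷ xs) u {zero}  {zero}  eq = refl
lookup-injective (x ∷ xs) u {zero}  {suc j} eq =
  contradiction (subst (_∈ xs) (sym eq) (∈-lookup j)) (proj₁ (Unique-∷⁻ u))
lookup-injective (x ∷ xs) u {suc i} {zero}  eq =
  contradiction (subst (_∈ xs) eq (∈-lookup i)) (proj₁ (Unique-∷⁻ u))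
lookup-injective (x ∷ xs) u {suc i} {suc j} eq =
  cong suc (lookup-injective xs (proj₂ (Unique-∷⁻ u)) eq)

Unique⇒length≤ : {xs : List (Fin n)} → Unique xs → length xs ≤ n
Unique⇒length≤ {xs = xs} u = injective⇒≤ (lookup-injective xs u)

unique? : (xs : List (Fin n)) → Dec (Unique xs)
unique? = DecUnique.unique? _≟_

_∈?_ : (v : Fin n) (xs : List (Fin n)) → Dec (v ∈ xs)
v ∈? xs = Any.any? (v ≟_) xs

∈-delete₂ : {Q : A → Set} → ¬ Q y → w ∈ x ∷ y ∷ xs → Q w → w ∈ x ∷ xs
∈-delete₂ ¬qy (here eq)           _ = here eq
∈-delete₂ ¬qy (there (here refl)) q = contradiction q ¬qy
∈-delete₂ ¬qy (there (there w∈))  _ = there w∈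

insert : Fin n → (Fin n → Bool) → Fin n → Bool
insert v p u = does (u ≟ v) ∨ p u

count : (Fin n → Bool) → ℕ
count {zero}  p = 0
count {suc n} p = indicator (p zero) + count (p ∘ suc)

indicator-mono : ∀ {a b} → (T a → T b) → indicator a ≤ indicator b
indicator-mono {false} f = z≤n
indicator-mono {true}  {true}  f = s≤s z≤n
indicator-mono {true}  {false} f = ⊥-elim (f tt)

count-mono : {p q : Fin n → Bool} → (∀ u → T (p u) → T (q u)) → count p ≤ count q
count-mono {zero}  f = z≤n
count-mono {suc n} f = ℕₚ.+-mono-≤ (indicator-mono (f zero)) (count-mono (f ∘ suc))

count-insert : ∀ v {p : Fin n → Bool} → ¬ T (p v) → count (insert v p) ≡ suc (count p)
count-insert zero {p} ¬pv with p zero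
... | true  = contradiction tt ¬pv
... | false = refl
count-insert (suc v) {p} ¬pv =
  trans (cong (indicator (p zero) +_) (count-insert v ¬pv)) (ℕₚ.+-suc _ _)

count≤ : (p : Fin n → Bool) → count p ≤ n
count≤ {zero}  p = z≤n
count≤ {suc n} p with p zero
... | true  = s≤s (count≤ (p ∘ suc))
... | false = ℕₚ.m≤n⇒m≤1+n (count≤ (p ∘ suc))

T-∨⁺ˡ : ∀ {a b} → T a → T (a ∨ b)
T-∨⁺ˡ {a} {b} = Equivalence.from (T-∨ {a} {b}) ∘ inj₁

T-∨⁺ʳ : ∀ a {b} → T b → T (a ∨ b)
T-∨⁺ʳ a {b} = Equivalence.from (T-∨ {a} {b}) ∘ inj₂

T-∨⁻ : ∀ a {b} → T (a ∨ b) → T a ⊎ T b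
T-∨⁻ a {b} = Equivalence.to (T-∨ {a} {b})

T-does⁺ : ∀ {P : Set} {d : Dec P} → P → T (does d)
T-does⁺ {d = yes _} p = tt
T-does⁺ {d = no ¬p} p = ¬p p

T-does⁻ : ∀ {P : Set} {d : Dec P} → T (does d) → P
T-does⁻ {d = yes p} t = p

T-diff⁻ : ∀ {a b} → T (a ∧ not b) → T a × ¬ T b
T-diff⁻ {true} {false} t = tt , id

T-diff⁺ : ∀ {a b} → T a → ¬ T b → T (a ∧ not b)
T-diff⁺ {true} {false} _ _  = tt
T-diff⁺ {true} {true}  _ ¬b = ¬b tt

count-< : ∀ v {p q : Fin n → Bool} → (∀ u → T (p u) → T (q u)) → T (q v) → ¬ T (p v) →
          count p < count q
count-< v {p} {q} p⊆q qv ¬pv = subst (_≤ count q) (count-insert v ¬pv) (count-mono insert⊆)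
  where
  insert⊆ : ∀ u → T (insert v p u) → T (q u)
  insert⊆ u t with T-∨⁻ (does (u ≟ v)) t
  ... | inj₁ u≡v = subst (T ∘ q) (sym (T-does⁻ {d = u ≟ v} u≡v)) qv
  ... | inj₂ pu  = p⊆q u pu

-- Path R u is v: an R-walk from u to v whose list of internal vertices is is.

data Path (R : A → A → Set) : A → List A → A → Set where
  ⟦_⟧ : R u v → Path R u [] v
  _∷_ : R u w → Path R w I v → Path R u (w ∷ I) v

module _ {R : A → A → Set} where

  toLinked : Path R u I v → Linked R (u ∷ I ∷ʳ v)
  toLinked ⟦ r ⟧   = r ∷ [-]
  toLinked (r ∷ p) = r ∷ toLinked p

  fromLinked : ∀ I → Linked R (u ∷ I ∷ʳ v) → Path R u I v
  fromLinked []      (r ∷ [-]) = ⟦ r ⟧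
  fromLinked (w ∷ I) (r ∷ l)   = r ∷ fromLinked I l

  concat : Path R u I v → Path R v J w → Path R u (I ++ v ∷ J) w
  concat ⟦ r ⟧   q = r ∷ q
  concat (r ∷ p) q = r ∷ concat p q

  split : ∀ I → Path R u (I ++ v ∷ J) w → Path R u I v × Path R v J w
  split []      (r ∷ p) = ⟦ r ⟧ , p
  split (x ∷ I) (r ∷ p) with split I p
  ... | p₁ , p₂ = r ∷ p₁ , p₂

  lastInternalHit : {Q : A → Set} → Decidable Q → Path R u I v → Unique I →
    (Σ A λ g → Σ (List A) λ J → Q g × g ∈ I × Path R g J v × Unique J ×
      (∀ {h} → h ∈ J → h ∈ I) × (∀ {h} → h ∈ J → ¬ Q h)) ⊎
    (∀ {h} → h ∈ I → ¬ Q h)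
  lastInternalHit Q? ⟦ r ⟧ _ = inj₂ λ ()
  lastInternalHit {I = w ∷ I} Q? (r ∷ p) uI
    with lastInternalHit Q? p (proj₂ (Unique-∷⁻ uI))
  ... | inj₁ (g , J , qg , g∈ , p′ , uJ , J⊆ , ¬q) =
        inj₁ (g , J , qg , there g∈ , p′ , uJ , there ∘ J⊆ , ¬q)
  ... | inj₂ none with Q? w
  ...   | yes qw = inj₁ (w , I , qw , here refl , p , proj₂ (Unique-∷⁻ uI) , there , none)
  ...   | no ¬qw = inj₂ λ { (here refl) → ¬qw ; (there h∈) → none h∈ }

  -- Cutting at the last visit to `Q` leaves a remainder free of `Q`. A new link uses this to leave
  -- an old chain for good.
  lastHit : {Q : A → Set} → Decidable Q → Path R u I v → Unique I → Q u →
            Σ A λ g → Σ (List A) λ J → Q g × g ∈ u ∷ I × Path R g J v ×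
            Unique J × (∀ {h} → h ∈ J → h ∈ I) × (∀ {h} → h ∈ J → ¬ Q h)
  lastHit {u = u} {I = I} Q? p uI q with lastInternalHit Q? p uI
  ... | inj₁ (g , J , qg , g∈ , rest) = g , J , qg , there g∈ , rest
  ... | inj₂ none = u , I , q , here refl , p , uI , id , none

  -- The end `v` counts as a possible hit, so a witness anywhere in `v ∷ I` suffices. Chains use
  -- this to stop as soon as they enter a given set.
  firstHit : {Q : A → Set} → Decidable Q → Path R u I v → Unique (v ∷ I) →
             w ∈ v ∷ I → Q w →
             Σ A λ h → Σ (List A) λ J → Q h × h ∈ v ∷ I × Path R u J h ×
             Unique (h ∷ J) × (∀ {g} → g ∈ J → g ∈ I) × (∀ {g} → g ∈ J → ¬ Q g)
  firstHit Q? ⟦ r ⟧ _ (here refl) q = _ , [] , q , here refl , ⟦ r ⟧ , [] ∷ [] , (λ ()) , λ ()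
  firstHit {I = y ∷ I} {v = v} Q? (r ∷ p) u w∈ q with Unique-∷⁻ u
  ... | v∉ , uI with Unique-∷⁻ uI
  ... | y∉ , uI′ with Q? y
  ... | yes qy = y , [] , qy , there (here refl) , ⟦ r ⟧ , [] ∷ [] , (λ ()) , λ ()
  ... | no ¬qy with firstHit Q? p (Unique-∷⁺ (v∉ ∘ there) uI′) (∈-delete₂ ¬qy w∈ q) q
  ...   | h , J , qh , h∈ , p′ , uJ , J⊆ , ¬q with Unique-∷⁻ uJ
  ...     | h∉J , uJ′ =
        h , y ∷ J , qh , weaken h∈ , r ∷ p′ ,
        Unique-∷⁺ (λ { (here refl) → ¬qy qh ; (there h∈J) → h∉J h∈J })
                  (Unique-∷⁺ (y∉ ∘ J⊆) uJ′) ,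
        (λ { (here eq) → here eq ; (there g∈) → there (J⊆ g∈) }) ,
        λ { (here refl) → ¬qy ; (there g∈) → ¬q g∈ }
    where
    weaken : ∀ {h} → h ∈ v ∷ I → h ∈ v ∷ y ∷ I
    weaken (here eq)  = here eq
    weaken (there h∈) = there (there h∈)

reversePath : {R : A → A → Set} → Path (flip R) u I v → Path R v (reverse I) u
reversePath ⟦ r ⟧ = ⟦ r ⟧
reversePath {I = w ∷ I} (r ∷ p) =
  subst (λ J → Path _ _ J _) (sym (unfold-reverse w I)) (concat (reversePath p) ⟦ r ⟧)

Unique-reverse : Unique xs → Unique (reverse xs)
Unique-reverse {xs = xs} = Unique-resp-↭ (↭-sym (↭-reverse xs))

-- Directed cycles cut into paths of either direction

data Sign : Set where
  out into : Sign

module Walks {n} (D : Digraph n) where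

  -- Traversal away from the root: along arcs for out, against them for into.
  Step : Sign → Fin n → Fin n → Set
  Step out  = Arc D
  Step into = flip (Arc D)

  -- The cycle read from a chosen start. A rotation changes the list, so only the membership
  -- relations `to` and `from` tie it to `Y`.
  record ClosedAt (y : Fin n) (Y : List (Fin n)) : Set where
    field
      tail  : List (Fin n)
      walk  : Path (Arc D) y tail y
      uniq  : Unique (y ∷ tail)
      to    : ∀ {h} → h ∈ y ∷ tail → h ∈ Y
      from  : ∀ {h} → h ∈ Y → h ∈ y ∷ tail

  closedAt : ∀ {Y y} → IsDirectedCycle D Y → y ∈ Y → ClosedAt y Y
  closedAt {x ∷ xs} (l , u) (here refl) = record
    { tail = xs ; walk = fromLinked xs l ; uniq = u ; to = id ; from = id }
  closedAt {x ∷ xs} {y} (l , u) (there y∈) with ∈-∃++ y∈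
  ... | I , J , refl with split I (fromLinked xs l)
  ...   | p , q = record
    { tail = J ++ x ∷ I ; walk = concat q p ; uniq = Unique-resp-↭ perm u
    ; to = ∈-resp-↭ (↭-sym perm) ; from = ∈-resp-↭ perm }
    where
    perm : x ∷ I ++ y ∷ J ↭ y ∷ J ++ x ∷ I
    perm = ++-comm (x ∷ I) (y ∷ J)

  record TwoPaths (y z : Fin n) (Y : List (Fin n)) : Set where
    field
      is js : List (Fin n)
      path→ : Path (Arc D) y is z
      path←  : Path (Arc D) z js y
      uniq  : Unique (y ∷ is ++ z ∷ js)
      is⊆   : ∀ {h} → h ∈ is → h ∈ Y
      js⊆   : ∀ {h} → h ∈ js → h ∈ Y

  twoPaths : ∀ {Y y z} → IsDirectedCycle D Y → y ∈ Y → z ∈ Y → y ≢ z → TwoPaths y z Y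
  twoPaths cyc y∈ z∈ y≢z with closedAt cyc y∈
  ... | C with ClosedAt.from C z∈
  ...   | here z≡y = contradiction (sym z≡y) y≢z
  ...   | there z∈t with ∈-∃++ z∈t
  ...     | I , J , eq with split I (subst (λ t → Path _ _ t _) eq (ClosedAt.walk C))
  ...       | p , q = record
    { is = I ; js = J ; path→ = p ; path← = q
    ; uniq = subst (λ t → Unique (_ ∷ t)) eq (ClosedAt.uniq C)
    ; is⊆ = λ h∈ → ClosedAt.to C (there (subst (_ ∈_) (sym eq) (∈-++⁺ˡ h∈)))
    ; js⊆ = λ h∈ → ClosedAt.to C (there (subst (_ ∈_) (sym eq) (∈-++⁺ʳ I (there h∈)))) }

  -- The two vertices cut the cycle into a path there and a path back; the second, read backwards,
  -- is the one of sign `into`. So a cycle supplies single links of both signs.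
  signedPath : ∀ σ {Y y z} → IsDirectedCycle D Y → y ∈ Y → z ∈ Y → y ≢ z →
    Σ (List (Fin n)) λ I → Path (Step σ) y I z × Unique (z ∷ I) × y ∉ z ∷ I ×
    (∀ {h} → h ∈ I → h ∈ Y)
  signedPath σ cyc y∈ z∈ y≢z with twoPaths cyc y∈ z∈ y≢z
  ... | record { is = I ; js = J ; path→ = p ; path← = q ; uniq = u ; is⊆ = I⊆ ; js⊆ = J⊆ }
      with Unique-∷⁻ u
  ... | y∉ , u′ with Unique-++⁻ I u′
  ... | uI , uzJ , dis with Unique-∷⁻ uzJ
  ... | z∉J , uJ with σ
  ...   | out  = I , p , Unique-∷⁺ (λ z∈I → dis z∈I (here refl)) uI ,
                 (λ { (here eq) → y≢z eq ; (there y∈I) → y∉ (∈-++⁺ˡ y∈I) }) , I⊆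
  ...   | into = reverse J , reversePath q ,
                 Unique-∷⁺ (z∉J ∘ reverse⁻) (Unique-reverse uJ) ,
                 (λ { (here eq) → y≢z eq
                    ; (there y∈J) → y∉ (∈-++⁺ʳ I (there (reverse⁻ y∈J))) }) , J⊆ ∘ reverse⁻

  anyList? : ∀ {P : List (Fin n) → Set} → Decidable P → ∀ m →
             Dec (Σ (List (Fin n)) λ xs → length xs ≤ m × P xs)
  anyList? P? zero with P? []
  ... | yes p = yes ([] , z≤n , p)
  ... | no ¬p = no λ { ([] , _ , p) → ¬p p }
  anyList? P? (suc m) with P? []
  ... | yes p = yes ([] , z≤n , p)
  ... | no ¬p with any? (λ x → anyList? (P? ∘ (x ∷_)) m)
  ...   | yes (x , xs , l , p) = yes (x ∷ xs , s≤s l , p)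
  ...   | no none = no λ { ([] , _ , p) → ¬p p ; (x ∷ xs , s≤s l , p) → none (x , xs , l , p) }

  cycle? : Decidable (IsDirectedCycle D)
  cycle? []       = no id
  cycle? (x ∷ xs) = linked? (λ u v → T? (arc D u v)) (x ∷ xs ∷ʳ x) ×-dec unique? (x ∷ xs)

  -- A cycle repeats no vertex and so has at most `n` entries; searching lists of bounded length
  -- decides the question.
  findCycle : ∀ {P : List (Fin n) → Set} → Decidable P →
              Dec (Σ (List (Fin n)) λ Y → IsDirectedCycle D Y × P Y)
  findCycle P? = map′ (λ (Y , _ , c) → Y , c) (λ (Y , cyc , p) → Y , Unique⇒length≤ (cycleUnique Y cyc) , cyc , p)
                      (anyList? (λ Y → cycle? Y ×-dec P? Y) n)
    where
    cycleUnique : ∀ Y → IsDirectedCycle D Y → Unique Y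
    cycleUnique (x ∷ xs) = proj₂

-- Recolouring along chains

data Kind : Set where
  single : Sign → Kind
  double : Kind

module Rooted {n} (D : Digraph n) (k₁ : ℕ) (e : ℕ → Kind) (s : Sign)
  (e-last : e (suc k₁) ≡ single s)
  (e-sep : ∀ j → e (suc j) ≡ double → ∃[ σ ] e j ≡ single σ)
  where

  open Walks D

  k : ℕ
  k = suc k₁

  -- The two internal lists of a double link are concatenated, so that one `Unique` also expresses
  -- that the paths are disjoint.
  data Link : Kind → Fin n → List (Fin n) → Fin n → Set where
    single : ∀ {σ a I w} → Path (Step σ) a I w → Link (single σ) a I w
    double : ∀ {a I J w} → Path (Arc D) a I w → Path (Arc D) w J a → Link double a (I ++ J) w

  signedLink : ∀ {K σ a I w} → K ≡ single σ → Path (Step σ) a I w → Link K a I w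
  signedLink refl = single

  doubleLink : ∀ {K a I J w} → K ≡ double → Path (Arc D) a I w → Path (Arc D) w J a →
               Link K a (I ++ J) w
  doubleLink refl = double

  linkPath : ∀ {K σ a I w} → K ≡ single σ → Link K a I w → Path (Step σ) a I w
  linkPath refl (single p) = p

  module From (x : Fin n) where

    -- Chain j w G: branch vertices x = w₀, …, wⱼ = w with consecutive ones joined by
    -- links of kinds e 1, …, e j; G lists every vertex used.
    data Chain : ℕ → Fin n → List (Fin n) → Set where
      root : Chain 0 x (x ∷ [])
      link : ∀ {j a G I w} → Chain j a G → Link (e (suc j)) a I w → Unique (w ∷ I) →
             (∀ {h} → h ∈ w ∷ I → h ∉ G) → Chain (suc j) w (w ∷ I ++ G)

    tip∈ : ∀ {j w G} → Chain j w G → w ∈ G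
    tip∈ root           = here refl
    tip∈ (link _ _ _ _) = here refl

    -- The last kind is `single s`, so a further path of sign `s` is absorbed into the last link.
    -- Chains that run through the colours more than once thus keep exactly `k` links.
    extendLast : ∀ {b G I h} → Chain k b G → Path (Step s) b I h → Unique (h ∷ I) →
      (∀ {g} → g ∈ h ∷ I → g ∉ G) →
      Σ (List (Fin n)) λ G′ → Chain k h G′ × (∀ {g} → g ∈ G′ → g ∈ h ∷ I ⊎ g ∈ G)
    extendLast {b} {I = I} {h = h} (link {G = G₀} {I = I₀} ch l u dis) p uI dis′ =
      _ , link ch (signedLink e-last (concat (linkPath e-last l) p)) uniq disj , mem
      where
      uniq : Unique (h ∷ I₀ ++ b ∷ I)
      uniq = Unique-resp-↭ (↭-prep h (↭-trans (++-comm I (b ∷ I₀)) (↭-sym (shift b I₀ I))))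
        (++⁺ uI u λ { (g∈ , here refl) → dis′ g∈ (here refl)
                    ; (g∈ , there g∈I₀) → dis′ g∈ (there (∈-++⁺ˡ g∈I₀)) })
      disj : ∀ {g} → g ∈ h ∷ I₀ ++ b ∷ I → g ∉ G₀
      disj (here refl) g∈ = dis′ (here refl) (there (∈-++⁺ʳ I₀ g∈))
      disj (there g∈′) g∈ with ∈-++⁻ I₀ g∈′
      ... | inj₁ g∈I₀        = dis (there g∈I₀) g∈
      ... | inj₂ (here refl) = dis (here refl) g∈
      ... | inj₂ (there g∈I) = dis′ (there g∈I) (there (∈-++⁺ʳ I₀ g∈))
      mem : ∀ {g} → g ∈ (h ∷ I₀ ++ b ∷ I) ++ G₀ → g ∈ h ∷ I ⊎ g ∈ b ∷ I₀ ++ G₀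
      mem g∈ with ∈-++⁻ (h ∷ I₀ ++ b ∷ I) g∈
      ... | inj₂ g∈G₀ = inj₂ (there (∈-++⁺ʳ I₀ g∈G₀))
      ... | inj₁ (here refl) = inj₁ (here refl)
      ... | inj₁ (there g∈′) with ∈-++⁻ I₀ g∈′
      ...   | inj₁ g∈I₀        = inj₂ (there (∈-++⁺ˡ g∈I₀))
      ...   | inj₂ (here refl) = inj₂ (here refl)
      ...   | inj₂ (there g∈I) = inj₁ (there g∈I)

    -- The recolouring rule; x starts with colour 0.
    next : ℕ → ℕ
    next j with j <? k
    ... | yes _ = suc j
    ... | no  _ = 1

    next-< : ∀ {j} → j < k → next j ≡ suc j
    next-< {j} j<k with j <? k
    ... | yes _  = refl
    ... | no j≮k = contradiction j<k j≮k

    next-k : next k ≡ 1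
    next-k with k <? k
    ... | yes k<k = contradiction k<k (ℕₚ.<-irrefl refl)
    ... | no  _   = refl

    1≤next : ∀ j → 1 ≤ next j
    1≤next j with j <? k
    ... | yes _ = s≤s z≤n
    ... | no  _ = s≤s z≤n

    -- Only `0` and `k` share a successor. As colour `0` belongs to `x` alone, a cycle that merges
    -- two old colours must pass through `x` and a moved vertex of colour `k`.
    next-collision : ∀ {i j} → i ≤ k → j ≤ k → next i ≡ next j → i ≢ j →
                     (i ≡ 0 × j ≡ k) ⊎ (i ≡ k × j ≡ 0)
    next-collision {i} {j} i≤k j≤k eq i≢j with i <? k | j <? k
    ... | yes _  | yes _  = contradiction (ℕₚ.suc-injective eq) i≢j
    ... | yes _  | no j≮k = inj₁ (ℕₚ.suc-injective eq , ℕₚ.≤-antisym j≤k (ℕₚ.≮⇒≥ j≮k))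
    ... | no i≮k | yes _  = inj₂ (ℕₚ.≤-antisym i≤k (ℕₚ.≮⇒≥ i≮k) , sym (ℕₚ.suc-injective eq))
    ... | no i≮k | no j≮k =
          contradiction (trans (ℕₚ.≤-antisym i≤k (ℕₚ.≮⇒≥ i≮k)) (ℕₚ.≤-antisym (ℕₚ.≮⇒≥ j≮k) j≤k)) i≢j

    module Coloured (c : Fin n → ℕ) (cx : c x ≡ 0) (c0 : ∀ {v} → c v ≡ 0 → v ≡ x)
      (acyclic : ∀ Y → IsDirectedCycle D Y → ∀ i → i ≤ k → ¬ All (λ y → c y ≡ i) Y)
      where

      Subset : Set
      Subset = Fin n → Bool

      -- The chain behind z has exactly j links. Colours keep it away from the cycles of
      -- later links, except at vertices of colour j, where it may be cut short:
      -- rebase and truncate provide the shorter chains.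
      record Exact (j : ℕ) (S : Subset) (z : Fin n) : Set where
        field
          G     : List (Fin n)
          z∈G   : z ∈ G
          cz    : c z ≡ j
          G⊆S   : ∀ {g} → g ∈ G → T (S g)
          G≤    : ∀ {g} → g ∈ G → c g ≤ j
          rebase : ∀ {g} → g ∈ G → c g ≡ j →
            Σ (List (Fin n)) λ G′ → Chain j g G′ × (∀ {h} → h ∈ G′ → h ∈ G)
          -- A single link can be stopped at its first vertex in `Z`. A double link cannot: its two
          -- paths form a whole cycle, which may meet `Z` repeatedly.
          truncate : ∀ {σ} → e j ≡ single σ → (Z : Subset) →
            ∀ {g} → g ∈ G → c g ≡ j → T (Z g) →
            Σ (Fin n) λ w → Σ (List (Fin n)) λ G′ → T (Z w) × c w ≡ j × Chain j w G′ ×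
              (∀ {h} → h ∈ G′ → h ∈ G) × (∀ {h} → h ∈ G′ → T (Z h) → c h ≡ j → h ≡ w)

      Exact-mono : ∀ {j S S′ z} → (∀ {v} → T (S v) → T (S′ v)) → Exact j S z → Exact j S′ z
      Exact-mono S⊆S′ E = record { Exact E ; G⊆S = S⊆S′ ∘ Exact.G⊆S E }

      Full : Subset → Subset → Set
      Full S Z = Σ (Fin n) λ b → Σ (List (Fin n)) λ G → T (Z b) × Chain k b G ×
        (∀ {g} → g ∈ G → T (S g)) × (∀ {g} → g ∈ G → T (Z g) → g ≡ b)

      -- Z stands for a cycle that is about to be attached to S. Only chains of full
      -- length k may revisit colours, so only they must be known to meet Z in the tip alone.
      Reached : Subset → Set
      Reached S = ∀ (Z : Subset) j → (∃[ z ] T (S z) × T (Z z)) →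
        (∀ z → T (S z) → T (Z z) → c z ≡ j) →
        (j < k × ∃[ a ] T (Z a) × Exact j S a) ⊎ Full S Z

      reached-root : Reached (insert x (λ _ → false))
      reached-root Z j (z , Sz , Zz) mono with T-∨⁻ (does (z ≟ x)) Sz
      ... | inj₁ t with refl ← T-does⁻ {d = z ≟ x} t with refl ← trans (sym cx) (mono x Sz Zz) =
        inj₁ (s≤s z≤n , x , Zz , record
          { G = x ∷ []
          ; z∈G = here refl
          ; cz = cx
          ; G⊆S = λ { (here refl) → Sz }
          ; G≤ = λ { (here refl) → ℕₚ.≤-reflexive cx }
          ; rebase = λ { (here refl) _ → x ∷ [] , root , id }
          ; truncate = λ { _ Z (here refl) _ Zx →
              x , x ∷ [] , Zx , cx , root , id , λ { (here refl) _ _ → refl } } })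

      -- A cycle that becomes monochromatic in colour `next j` once the vertices of `S` have moved
      -- on by one colour.
      record Conflict (S : Subset) (j : ℕ) : Set where
        field
          Y     : List (Fin n)
          cycle : IsDirectedCycle D Y
          sorted : ∀ {y} → y ∈ Y → (T (S y) × c y ≡ j) ⊎ (¬ T (S y) × c y ≡ next j)
          old   : ∃[ a ] a ∈ Y × T (S a)
          new   : ∃[ z ] z ∈ Y × ¬ T (S z)

      module Grow {S j} (C : Conflict S j) where
        open Conflict C

        S′ : Subset
        S′ v = S v ∨ does (v ∈? Y)

        S⊆S′ : ∀ {v} → T (S v) → T (S′ v)
        S⊆S′ = T-∨⁺ˡ

        Y⊆S′ : ∀ {v} → v ∈ Y → T (S′ v)
        Y⊆S′ {v} v∈ = T-∨⁺ʳ (S v) (T-does⁺ {d = v ∈? Y} v∈)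

        S′⁻ : ∀ {v} → T (S′ v) → T (S v) ⊎ v ∈ Y
        S′⁻ {v} t with T-∨⁻ (S v) t
        ... | inj₁ Sv = inj₁ Sv
        ... | inj₂ t′ = inj₂ (T-does⁻ {d = v ∈? Y} t′)

        old-colour : ∀ {y} → y ∈ Y → T (S y) → c y ≡ j
        old-colour y∈ Sy with sorted y∈
        ... | inj₁ (_ , eq)  = eq
        ... | inj₂ (¬Sy , _) = contradiction Sy ¬Sy

        new-colour : ∀ {y} → y ∈ Y → ¬ T (S y) → c y ≡ next j
        new-colour y∈ ¬Sy with sorted y∈
        ... | inj₁ (Sy , _) = contradiction Sy ¬Sy
        ... | inj₂ (_ , eq) = eq

        old≢new : ∀ {y z} → T (S y) → ¬ T (S z) → y ≢ z
        old≢new Sy ¬Sz refl = ¬Sz Sy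

        module Advance (j<k : j < k) {a} (a∈Y : a ∈ Y) (E : Exact j S a)
                       {z} (z∈Y : z ∈ Y) (¬Sz : ¬ T (S z)) where
          open Exact E

          Y≤ : ∀ {y} → y ∈ Y → c y ≤ suc j
          Y≤ y∈ with sorted y∈
          ... | inj₁ (_ , eq) = ℕₚ.m≤n⇒m≤1+n (ℕₚ.≤-reflexive eq)
          ... | inj₂ (_ , eq) = ℕₚ.≤-reflexive (trans eq (next-< j<k))

          cz′ : c z ≡ suc j
          cz′ = trans (new-colour z∈Y ¬Sz) (next-< j<k)

          -- The walk along the cycle from `a` to `z` may run into `G` again. Every meeting point is
          -- an old vertex of the cycle, hence of colour `j`, so `rebase` provides a chain ending at
          -- the last of them.
          viaSingle : ∀ {σ} → e (suc j) ≡ single σ → Exact (suc j) S′ z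
          viaSingle {σ} eσ with signedPath σ cycle a∈Y z∈Y (old≢new (G⊆S z∈G) ¬Sz)
          ... | I , p , uzI , _ , I⊆ with Unique-∷⁻ uzI
          ... | z∉I , uI with lastHit (_∈? G) p uI z∈G
          ... | g , J , g∈G , g∈aI , q , uJ , J⊆ , J∉G
              with rebase g∈G (old-colour (aI⊆ g∈aI) (G⊆S g∈G))
            where
            aI⊆ : ∀ {h} → h ∈ a ∷ I → h ∈ Y
            aI⊆ (here refl) = a∈Y
            aI⊆ (there h∈)  = I⊆ h∈
          ... | G₀ , ch , G₀⊆ = record
            { G = z ∷ J ++ G₀
            ; z∈G = here refl
            ; cz = cz′
            ; G⊆S = G⊆
            ; G≤ = bound
            ; rebase = rebased
            ; truncate = λ _ → trunc }
            where
            zJ⊆ : ∀ {h} → h ∈ z ∷ J → h ∈ Y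
            zJ⊆ (here refl) = z∈Y
            zJ⊆ (there h∈)  = I⊆ (J⊆ h∈)
            G⊆ : ∀ {h} → h ∈ (z ∷ J) ++ G₀ → T (S′ h)
            G⊆ h∈ with ∈-++⁻ (z ∷ J) h∈
            ... | inj₁ h∈zJ = Y⊆S′ (zJ⊆ h∈zJ)
            ... | inj₂ h∈G₀ = S⊆S′ (G⊆S (G₀⊆ h∈G₀))
            bound : ∀ {h} → h ∈ (z ∷ J) ++ G₀ → c h ≤ suc j
            bound h∈ with ∈-++⁻ (z ∷ J) h∈
            ... | inj₁ h∈zJ = Y≤ (zJ⊆ h∈zJ)
            ... | inj₂ h∈G₀ = ℕₚ.m≤n⇒m≤1+n (G≤ (G₀⊆ h∈G₀))
            uzJ : Unique (z ∷ J)
            uzJ = Unique-∷⁺ (z∉I ∘ J⊆) uJ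
            G₀-low : ∀ {h} → h ∈ G₀ → c h ≢ suc j
            G₀-low h∈ eq = ℕₚ.<-irrefl refl (subst (_≤ j) eq (G≤ (G₀⊆ h∈)))
            trunc : (Z : Subset) → ∀ {h} → h ∈ (z ∷ J) ++ G₀ → c h ≡ suc j → T (Z h) →
              Σ (Fin n) λ w → Σ (List (Fin n)) λ G′ → T (Z w) × c w ≡ suc j × Chain (suc j) w G′ ×
              (∀ {i} → i ∈ G′ → i ∈ (z ∷ J) ++ G₀) ×
              (∀ {i} → i ∈ G′ → T (Z i) → c i ≡ suc j → i ≡ w)
            trunc Z h∈ ch≡ Zh with ∈-++⁻ (z ∷ J) h∈
            ... | inj₂ h∈G₀ = contradiction ch≡ (G₀-low h∈G₀)
            -- Old vertices of the cycle, of colour `j`, may lie on this link and in `Z` as well.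
            -- The search must pass over them to a vertex of colour `suc j`.
            ... | inj₁ h∈zJ
                with firstHit (λ i → T? (Z i) ×-dec (c i ℕ.≟ suc j)) q uzJ h∈zJ (Zh , ch≡)
            ...   | w , K , (Zw , cw) , w∈zJ , r , uwK , K⊆ , K-miss =
              w , w ∷ K ++ G₀ , Zw , cw , link ch (signedLink eσ r) uwK disj , sub⊆ , last
              where
              disj : ∀ {i} → i ∈ w ∷ K → i ∉ G₀
              disj (here refl) i∈ = G₀-low i∈ cw
              disj (there i∈K) i∈ = J∉G (K⊆ i∈K) (G₀⊆ i∈)
              sub⊆ : ∀ {i} → i ∈ (w ∷ K) ++ G₀ → i ∈ (z ∷ J) ++ G₀
              sub⊆ i∈ with ∈-++⁻ (w ∷ K) i∈
              ... | inj₁ (here refl)  = ∈-++⁺ˡ w∈zJ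
              ... | inj₁ (there i∈K) = there (∈-++⁺ˡ (K⊆ i∈K))
              ... | inj₂ i∈G₀        = there (∈-++⁺ʳ J i∈G₀)
              last : ∀ {i} → i ∈ (w ∷ K) ++ G₀ → T (Z i) → c i ≡ suc j → i ≡ w
              last i∈ Zi ci with ∈-++⁻ (w ∷ K) i∈
              ... | inj₁ (here refl) = refl
              ... | inj₁ (there i∈K) = contradiction (Zi , ci) (K-miss i∈K)
              ... | inj₂ i∈G₀        = contradiction ci (G₀-low i∈G₀)
            rebased : ∀ {h} → h ∈ (z ∷ J) ++ G₀ → c h ≡ suc j →
              Σ (List (Fin n)) λ G′ → Chain (suc j) h G′ × (∀ {i} → i ∈ G′ → i ∈ (z ∷ J) ++ G₀)
            -- Rebasing at `h` is truncation at the one-vertex set of `h`.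
            rebased {h} h∈ ch≡ with trunc (λ i → does (i ≟ h)) h∈ ch≡ (T-does⁺ {d = h ≟ h} refl)
            ... | w , G′ , w≡h , _ , chain , G′⊆ , _ with refl ← T-does⁻ {d = w ≟ h} w≡h =
              G′ , chain , G′⊆

          -- By `e-sep` the preceding kind is single, so the chain can first be cut to meet the
          -- cycle in one vertex `b`. The whole cycle is then a double link from `b` to any of its
          -- vertices of colour `suc j`.
          viaDouble : e (suc j) ≡ double → Exact (suc j) S′ z
          viaDouble e≡ with e-sep j e≡
          ... | σ , ej with truncate ej (λ v → does (v ∈? Y)) z∈G cz (T-does⁺ {d = a ∈? Y} a∈Y)
          ... | b , G₀ , b∈ , cb , ch , G₀⊆ , only = record
            { G = Y ++ G₀
            ; z∈G = ∈-++⁺ˡ z∈Y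
            ; cz = cz′
            ; G⊆S = λ h∈ → [ Y⊆S′ , S⊆S′ ∘ G⊆S ∘ G₀⊆ ]′ (∈-++⁻ Y h∈)
            ; G≤ = λ h∈ → [ Y≤ , ℕₚ.m≤n⇒m≤1+n ∘ G≤ ∘ G₀⊆ ]′ (∈-++⁻ Y h∈)
            ; rebase = λ h∈ ch≡ → [ (λ h∈Y → cycleLink h∈Y ch≡)
                                  , (λ h∈G₀ → contradiction ch≡ (G₀-low h∈G₀)) ]′ (∈-++⁻ Y h∈)
            ; truncate = λ e≡′ → contradiction (trans (sym e≡′) e≡) λ () }
            where
            b∈Y : b ∈ Y
            b∈Y = T-does⁻ {d = b ∈? Y} b∈
            G₀-low : ∀ {h} → h ∈ G₀ → c h ≢ suc j
            G₀-low h∈ eq = ℕₚ.<-irrefl refl (subst (_≤ j) eq (G≤ (G₀⊆ h∈)))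
            meet : ∀ {h} → h ∈ Y → h ∈ G₀ → h ≡ b
            meet {h} h∈Y h∈ =
              only h∈ (T-does⁺ {d = h ∈? Y} h∈Y) (old-colour h∈Y (G⊆S (G₀⊆ h∈)))
            cycleLink : ∀ {w} → w ∈ Y → c w ≡ suc j →
              Σ (List (Fin n)) λ G′ → Chain (suc j) w G′ × (∀ {h} → h ∈ G′ → h ∈ Y ++ G₀)
            cycleLink {w} w∈Y cw with twoPaths cycle b∈Y w∈Y b≢w
              where
              b≢w : b ≢ w
              b≢w refl = G₀-low (tip∈ ch) cw
            ... | tp with Unique-∷⁻ (TwoPaths.uniq tp)
            ... | b∉ , u = _ ,
              link ch (doubleLink e≡ (TwoPaths.path→ tp) (TwoPaths.path← tp)) u′ disj , sub⊆
              where
              open TwoPaths tp using (is; js; is⊆; js⊆)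
              u′ : Unique (w ∷ is ++ js)
              u′ = Unique-resp-↭ (shift w is js) u
              wIJ⊆ : ∀ {h} → h ∈ w ∷ is ++ js → h ∈ Y
              wIJ⊆ (here refl) = w∈Y
              wIJ⊆ (there h∈)  = [ is⊆ , js⊆ ]′ (∈-++⁻ is h∈)
              disj : ∀ {h} → h ∈ w ∷ is ++ js → h ∉ G₀
              disj h∈ h∈G₀ with refl ← meet (wIJ⊆ h∈) h∈G₀ = b∉ (∈-resp-↭ (↭-sym (shift w is js)) h∈)
              sub⊆ : ∀ {h} → h ∈ (w ∷ is ++ js) ++ G₀ → h ∈ Y ++ G₀
              sub⊆ h∈ = [ ∈-++⁺ˡ ∘ wIJ⊆ , ∈-++⁺ʳ Y ]′ (∈-++⁻ (w ∷ is ++ js) h∈)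

          advance : Exact (suc j) S′ z
          advance with e (suc j) in eq
          ... | single σ = viaSingle eq
          ... | double   = viaDouble eq

        -- If `Z` meets `S`, the old witness still serves. Otherwise `Z` meets `S′` only in new
        -- vertices of the conflict cycle; the hypothesis is applied to that cycle in place of `Z`,
        -- and the chain obtained is continued along it.
        grow : Reached S → Reached S′
        grow R Z i meets mono with any? (λ z → T? (S z) ×-dec T? (Z z))
        ... | yes meetsS with R Z i meetsS (λ z Sz → mono z (S⊆S′ Sz))
        ...   | inj₁ (i<k , a , Za , E) = inj₁ (i<k , a , Za , Exact-mono S⊆S′ E)
        ...   | inj₂ (b , G , Zb , ch , G⊆ , only) = inj₂ (b , G , Zb , ch , S⊆S′ ∘ G⊆ , only)
        grow R Z i (z , S′z , Zz) mono | no missS with S′⁻ S′z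
        ... | inj₁ Sz  = contradiction (z , Sz , Zz) missS
        ... | inj₂ z∈Y with ¬Sz ← (λ Sz → missS (z , Sz , Zz))
            with R (λ v → does (v ∈? Y)) j
                   (let (a , a∈ , Sa) = old in a , Sa , T-does⁺ {d = a ∈? Y} a∈)
                   (λ y Sy y∈ → old-colour (T-does⁻ {d = y ∈? Y} y∈) Sy)
        ... | inj₁ (j<k , a , a∈ , E) = fromExact (Advance.advance j<k (T-does⁻ {d = a ∈? Y} a∈) E z∈Y ¬Sz)
          where
          i≡ : i ≡ suc j
          i≡ = trans (sym (mono z S′z Zz)) (trans (new-colour z∈Y ¬Sz) (next-< j<k))
          fromExact : Exact (suc j) S′ z → (i < k × ∃[ a ] T (Z a) × Exact i S′ a) ⊎ Full S′ Z
          fromExact E′ with ℕₚ.m≤n⇒m<n∨m≡n j<k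
          ... | inj₁ sj<k = inj₁ (subst (_< k) (sym i≡) sj<k , z , Zz , subst (λ i → Exact i S′ z) (sym i≡) E′)
          -- Here `suc j` is `k`: the chain is complete, and its single last link can be cut to meet
          -- `Z` in the tip alone.
          ... | inj₂ refl with Exact.truncate E′ e-last Z (Exact.z∈G E′) (Exact.cz E′) Zz
          ...   | w , G′ , Zw , _ , ch , G′⊆ , only = inj₂ (w , G′ , Zw , ch , Exact.G⊆S E′ ∘ G′⊆ ,
                  λ g∈ Zg → only g∈ Zg (trans (mono _ (Exact.G⊆S E′ (G′⊆ g∈)) Zg) i≡))
        -- The full chain meets the cycle in `b` alone, so its last link can be prolonged along the
        -- cycle, with sign `s`, to the first vertex of `Z`.
        ... | inj₂ (b , G , b∈ , ch , G⊆ , only)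
            with signedPath s cycle (T-does⁻ {d = b ∈? Y} b∈) z∈Y (old≢new (G⊆ (tip∈ ch)) ¬Sz)
        ... | I , p , uzI , b∉ , I⊆ with firstHit (T? ∘ Z) p uzI (here refl) Zz
        ... | h , J , Zh , h∈ , q , uhJ , J⊆ , J-miss = extended
          where
          hJ⊆ : ∀ {g} → g ∈ h ∷ J → g ∈ z ∷ I
          hJ⊆ (here refl) = h∈
          hJ⊆ (there g∈)  = there (J⊆ g∈)
          zI⊆ : ∀ {g} → g ∈ z ∷ I → g ∈ Y
          zI⊆ (here refl) = z∈Y
          zI⊆ (there g∈)  = I⊆ g∈
          disj : ∀ {g} → g ∈ h ∷ J → g ∉ G
          disj {g} g∈ g∈G with refl ← only g∈G (T-does⁺ {d = g ∈? Y} (zI⊆ (hJ⊆ g∈))) = b∉ (hJ⊆ g∈)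
          extended : (i < k × ∃[ a ] T (Z a) × Exact i S′ a) ⊎ Full S′ Z
          extended with extendLast ch q uhJ disj
          ... | G′ , ch′ , mem = inj₂ (h , G′ , Zh , ch′ ,
            (λ g∈ → [ Y⊆S′ ∘ zI⊆ ∘ hJ⊆ , S⊆S′ ∘ G⊆ ]′ (mem g∈)) ,
            λ g∈ Zg → [ (λ { (here eq) → eq ; (there g∈J) → contradiction Zg (J-miss g∈J) })
                      , (λ g∈G → contradiction (_ , G⊆ g∈G , Zg) missS) ]′ (mem g∈))

      -- The two paths between `x` and the tip `b` subdivide the digon that closes the chain.
      -- Colours at most `k` keep everything inside the coloured set together with `x`.
      record Ear : Set where
        field
          {b}   : Fin n
          {G}   : List (Fin n)
          chain : Chain k b G
          G≤    : ∀ {g} → g ∈ G → c g ≤ k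
          {is js} : List (Fin n)
          path→ : Path (Arc D) x is b
          path← : Path (Arc D) b js x
          uniq  : Unique (x ∷ is ++ b ∷ js)
          is-fresh : ∀ {h} → h ∈ is → c h ≤ k × h ∉ G
          js-fresh : ∀ {h} → h ∈ js → c h ≤ k × h ∉ G

      -- The outcome in which `x` joins the coloured set: `inside` applies to `x`, and `positive`
      -- says that the auxiliary colour `0` has disappeared.
      record Recolouring : Set where
        field
          c′       : Fin n → ℕ
          positive : ∀ v → 1 ≤ c′ v
          inside   : ∀ v → c v ≤ k → c′ v ≤ k
          outside  : ∀ v → ¬ c v ≤ k → c′ v ≡ c v
          acyclic′ : ∀ Y → IsDirectedCycle D Y → ∀ i → i ≤ k → ¬ All (λ y → c′ y ≡ i) Y

      next≤ : ∀ {j} → next j ≤ k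
      next≤ {j} with j <? k
      ... | yes j<k = j<k
      ... | no  _   = s≤s z≤n

      module Shift (S : Subset) (Sx : T (S x)) (S≤ : ∀ {v} → T (S v) → c v ≤ k)
                   (R : Reached S) where

        shift-colour : Fin n → ℕ
        shift-colour v = if S v then next (c v) else c v

        shift-in : ∀ {v} → T (S v) → shift-colour v ≡ next (c v)
        shift-in {v} Sv with S v
        ... | true = refl

        shift-out : ∀ {v} → ¬ T (S v) → shift-colour v ≡ c v
        shift-out {v} ¬Sv with S v
        ... | true  = contradiction tt ¬Sv
        ... | false = refl

        recolour : (∀ Y → IsDirectedCycle D Y → ∀ i → i ≤ k → ¬ All (λ y → shift-colour y ≡ i) Y) →
                   Recolouring
        recolour acyclic′ = record
          { c′ = shift-colour
          ; positive = pos
          ; inside = ins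
          ; outside = λ v v≰k → shift-out (v≰k ∘ S≤)
          ; acyclic′ = acyclic′ }
          where
          pos : ∀ v → 1 ≤ shift-colour v
          pos v with T? (S v)
          ... | yes Sv = subst (1 ≤_) (sym (shift-in Sv)) (1≤next (c v))
          ... | no ¬Sv = subst (1 ≤_) (sym (shift-out ¬Sv))
                (ℕₚ.n≢0⇒n>0 λ cv≡0 → ¬Sv (subst (T ∘ S) (sym (c0 cv≡0)) Sx))
          ins : ∀ v → c v ≤ k → shift-colour v ≤ k
          ins v v≤k with T? (S v)
          ... | yes Sv = subst (_≤ k) (sym (shift-in Sv)) next≤
          ... | no ¬Sv = subst (_≤ k) (sym (shift-out ¬Sv)) v≤k

        module _ {Y} (cycle : IsDirectedCycle D Y) {i} (i≤k : i ≤ k)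
                 (mono : ∀ {y} → y ∈ Y → shift-colour y ≡ i) where

          next≡ : ∀ {y} → y ∈ Y → T (S y) → next (c y) ≡ i
          next≡ y∈ Sy = trans (sym (shift-in Sy)) (mono y∈)

          colour≡ : ∀ {y} → y ∈ Y → ¬ T (S y) → c y ≡ i
          colour≡ y∈ ¬Sy = trans (sym (shift-out ¬Sy)) (mono y∈)

          -- The common new colour is `1`, so the other vertices of the cycle in `S` had colour `k`.
          -- At that colour `Reached` can only offer a full chain. It meets the cycle in its tip and
          -- `x`, and the cycle itself subdivides the closing digon.
          close : x ∈ Y → ∀ {b} → b ∈ Y → T (S b) → c b ≡ k → Ear
          close x∈ {b} b∈ Sb cb = fromFull (R Z k (b , Sb , Z⁺ b∈ b≢x) monoZ)
            where
            Z : Subset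
            -- Every chain starts at `x`, so `x` must be left out of a set that is to be met in the
            -- tip alone.
            Z v = does (v ∈? Y) ∧ not (does (v ≟ x))
            Z⁺ : ∀ {v} → v ∈ Y → v ≢ x → T (Z v)
            Z⁺ {v} v∈ v≢x with v ∈? Y | v ≟ x
            ... | _      | yes v≡x = contradiction v≡x v≢x
            ... | yes _  | no _    = tt
            ... | no v∉  | no _    = contradiction v∈ v∉
            Z⁻ : ∀ {v} → T (Z v) → v ∈ Y × v ≢ x
            Z⁻ {v} t with v ∈? Y | v ≟ x
            ... | yes v∈ | no v≢x = v∈ , v≢x
            b≢x : b ≢ x
            b≢x refl with () ← trans (sym cx) cb
            i≡1 : i ≡ 1
            i≡1 = trans (sym (next≡ b∈ Sb)) (trans (cong next cb) next-k)
            monoZ : ∀ z → T (S z) → T (Z z) → c z ≡ k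
            monoZ z Sz Zz with c z ℕ.≟ k
            ... | yes eq = eq
            ... | no neq with Z⁻ Zz
            ...   | z∈ , z≢x with next-collision (S≤ Sz) ℕₚ.≤-refl
                      (trans (next≡ z∈ Sz) (trans i≡1 (sym next-k))) neq
            ...     | inj₁ (cz≡0 , _) = contradiction (c0 cz≡0) z≢x
            ...     | inj₂ (cz≡k , _) = cz≡k
            fromFull : (k < k × ∃[ a ] T (Z a) × Exact k S a) ⊎ Full S Z → Ear
            fromFull (inj₁ (k<k , _)) = contradiction k<k (ℕₚ.<-irrefl refl)
            fromFull (inj₂ (w , G , Zw , ch , G⊆ , only)) with Z⁻ Zw
            ... | w∈ , w≢x with twoPaths cycle x∈ w∈ (w≢x ∘ sym)
            ... | tp with Unique-∷⁻ (TwoPaths.uniq tp)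
            ... | x∉ , u with Unique-++⁻ (TwoPaths.is tp) u
            ... | _ , uwj , dis = record
              { chain = ch
              ; G≤ = S≤ ∘ G⊆
              ; path→ = TwoPaths.path→ tp
              ; path← = TwoPaths.path← tp
              ; uniq = TwoPaths.uniq tp
              ; is-fresh = λ h∈ → fresh (TwoPaths.is⊆ tp h∈) (λ { refl → x∉ (∈-++⁺ˡ h∈) })
                                        (λ { refl → dis h∈ (here refl) })
              ; js-fresh = λ h∈ → fresh (TwoPaths.js⊆ tp h∈)
                                        (λ { refl → x∉ (∈-++⁺ʳ (TwoPaths.is tp) (there h∈)) })
                                        (λ { refl → proj₁ (Unique-∷⁻ uwj) h∈ }) }
              where
              fresh : ∀ {h} → h ∈ Y → h ≢ x → h ≢ w → c h ≤ k × h ∉ G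
              fresh {h} h∈ h≢x h≢w = bound , λ h∈G → h≢w (only h∈G (Z⁺ h∈ h≢x))
                where
                bound : c h ≤ k
                bound with T? (S h)
                ... | yes Sh = S≤ Sh
                ... | no ¬Sh = subst (_≤ k) (sym (colour≡ h∈ ¬Sh)) i≤k

          -- A cycle without vertices of `S` would have been monochromatic before. If its vertices
          -- in `S` had two different colours, an ear closes. Otherwise it is a conflict, and some
          -- vertex lies outside `S` because `c` was acyclic.
          analyse : Ear ⊎ ∃[ j ] j ≤ k × Conflict S j
          analyse with Any.any? (T? ∘ S) Y
          ... | no none = contradiction
                (All.tabulate λ y∈ → colour≡ y∈ λ Sy → none (Any.map (λ { refl → Sy }) y∈))
                (acyclic Y cycle i i≤k)
          ... | yes some with find some
          ...   | a , a∈ , Sa with Any.any? (λ z → T? (S z) ×-dec ¬? (c z ℕ.≟ c a)) Y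
          ...     | yes other with find other
          ...       | z , z∈ , Sz , cz≢ with next-collision (S≤ Sz) (S≤ Sa)
                        (trans (next≡ z∈ Sz) (sym (next≡ a∈ Sa))) cz≢
          ...         | inj₁ (cz≡0 , ca≡k) = inj₁ (close (subst (_∈ Y) (c0 cz≡0) z∈) a∈ Sa ca≡k)
          ...         | inj₂ (cz≡k , ca≡0) = inj₁ (close (subst (_∈ Y) (c0 ca≡0) a∈) z∈ Sz cz≡k)
          analyse | yes some | a , a∈ , Sa | no same = inj₂ (c a , S≤ Sa , record
            { Y = Y ; cycle = cycle ; sorted = srt ; old = a , a∈ , Sa ; new = fresh })
            where
            old≡ : ∀ {y} → y ∈ Y → T (S y) → c y ≡ c a
            old≡ {y} y∈ Sy with c y ℕ.≟ c a
            ... | yes eq = eq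
            ... | no neq = contradiction (Any.map (λ { refl → Sy , neq }) y∈) same
            srt : ∀ {y} → y ∈ Y → (T (S y) × c y ≡ c a) ⊎ (¬ T (S y) × c y ≡ next (c a))
            srt {y} y∈ with T? (S y)
            ... | yes Sy = inj₁ (Sy , old≡ y∈ Sy)
            ... | no ¬Sy = inj₂ (¬Sy , trans (colour≡ y∈ ¬Sy) (sym (next≡ a∈ Sa)))
            fresh : ∃[ z ] z ∈ Y × ¬ T (S z)
            fresh with Any.any? (¬? ∘ T? ∘ S) Y
            ... | yes some′ = find some′
            ... | no none = contradiction
                  (All.tabulate λ {y} y∈ → old≡ y∈ (decidable-stable (T? (S y))
                     λ ¬Sy → none (Any.map (λ { refl → ¬Sy }) y∈)))
                  (acyclic Y cycle (c a) (S≤ Sa))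

        advance : Recolouring ⊎ Ear ⊎ ∃[ j ] j ≤ k × Conflict S j
        advance with findCycle (λ Y → any? λ (i : Fin (suc k)) →
                                  All.all? (λ y → shift-colour y ℕ.≟ toℕ i) Y)
        ... | no none = inj₁ (recolour λ Y cyc i i≤k mono →
                none (Y , cyc , fromℕ< (s≤s i≤k) ,
                      All.map (λ eq → trans eq (sym (toℕ-fromℕ< (s≤s i≤k)))) mono))
        ... | yes (Y , cyc , i , mono) =
                inj₂ (analyse cyc (s≤s⁻¹ (toℕ<n i)) (All.lookup mono))

      -- Every conflict enlarges `S`, so `fuel + count S` never falls to `n`; with no fuel left `S`
      -- would exceed the vertex set.
      process : ∀ fuel (S : Subset) → T (S x) → (∀ {v} → T (S v) → c v ≤ k) → Reached S →
                n < fuel + count S → Recolouring ⊎ Ear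
      process zero S Sx S≤ R n< = contradiction (count≤ S) (ℕₚ.<⇒≱ n<)
      process (suc fuel) S Sx S≤ R n< with Shift.advance S Sx S≤ R
      ... | inj₁ recoloured = inj₁ recoloured
      ... | inj₂ (inj₁ ear) = inj₂ ear
      ... | inj₂ (inj₂ (j , j≤k , C)) =
            process fuel S′ (S⊆S′ Sx) S′≤ (grow R)
              (ℕₚ.<-≤-trans n< (subst (_≤ fuel + count S′) (ℕₚ.+-suc fuel (count S))
                (ℕₚ.+-monoʳ-≤ fuel bigger)))
        where
        open Grow C
        open Conflict C
        bigger : count S < count S′
        bigger with new
        ... | z , z∈ , ¬Sz = count-< z (λ _ → S⊆S′) (Y⊆S′ z∈) ¬Sz
        S′≤ : ∀ {v} → T (S′ v) → c v ≤ k
        S′≤ S′v with S′⁻ S′v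
        ... | inj₁ Sv = S≤ Sv
        ... | inj₂ v∈ with sorted v∈
        ...   | inj₁ (_ , eq) = ℕₚ.≤-trans (ℕₚ.≤-reflexive eq) j≤k
        ...   | inj₂ (_ , eq) = ℕₚ.≤-trans (ℕₚ.≤-reflexive eq) next≤

      recolour-or-ear : Recolouring ⊎ Ear
      recolour-or-ear = process (suc n) S₀ (T-∨⁺ˡ (T-does⁺ {d = x ≟ x} refl)) S₀≤ reached-root
                                (ℕₚ.m≤m+n (suc n) (count S₀))
        where
        S₀ : Subset
        S₀ = insert x (λ _ → false)
        S₀≤ : ∀ {v} → T (S₀ v) → c v ≤ k
        S₀≤ {v} t with T-∨⁻ (does (v ≟ x)) t
        ... | inj₁ t′ with refl ← T-does⁻ {d = v ≟ x} t′ = subst (_≤ k) (sym cx) z≤n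

-- Maximal coloured sets

-- Only cycles inside `q` are tested, so induced subdigraphs need no renumbering of vertices.
ColourableOn : ∀ {n} → Digraph n → (Fin n → Bool) → ℕ → Set
ColourableOn {n} D q m = Σ (Fin n → ℕ) λ c → (∀ v → T (q v) → c v < m) ×
  (∀ Y → IsDirectedCycle D Y → All (T ∘ q) Y → ∀ i → ¬ All (λ y → c y ≡ i) Y)

AtLeastOn : ∀ {n} → Digraph n → (Fin n → Bool) → ℕ → Set
AtLeastOn D q m = ∀ k → k < m → ¬ ColourableOn D q k

AtLeastOn-mono : ∀ {n} {D : Digraph n} {q l m} → l ≤ m → AtLeastOn D q m → AtLeastOn D q l
AtLeastOn-mono l≤m χ k k<l = χ k (ℕₚ.<-≤-trans k<l l≤m)

constant-cycle : ∀ {n} {D : Digraph n} → Loopless D → ∀ Y → IsDirectedCycle D Y →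
                 ∀ x → ¬ (∀ {y} → y ∈ Y → y ≡ x)
constant-cycle ll (y ∷ [])     (l ∷ _ , _) x eq = ll y l
constant-cycle ll (y ∷ z ∷ zs) (_ , u)     x eq =
  proj₁ (Unique-∷⁻ u) (here (trans (eq (here refl)) (sym (eq (there (here refl))))))

-- Colours 1, …, k mark the coloured vertices; larger values mean uncoloured.
record PartialColouring {n} (D : Digraph n) (q : Fin n → Bool) (k : ℕ) (c : Fin n → ℕ) : Set where
  field
    positive : ∀ v → 1 ≤ c v
    within   : ∀ v → c v ≤ k → T (q v)
    acyclic  : ∀ Y → IsDirectedCycle D Y → ∀ i → i ≤ k → ¬ All (λ y → c y ≡ i) Y

module Reserve {n} (D : Digraph n) (loopless : Loopless D) (q : Fin n → Bool)
  (k₁ : ℕ) (e : ℕ → Kind) (s : Sign) (e-last : e (suc k₁) ≡ single s)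
  (e-sep : ∀ j → e (suc j) ≡ double → ∃[ σ ] e j ≡ single σ) where

  open Rooted D k₁ e s e-last e-sep

  record EarIn (X : Fin n → Set) (x : Fin n) : Set where
    field
      {b}   : Fin n
      {G}   : List (Fin n)
      chain : From.Chain x k b G
      G-in  : ∀ {g} → g ∈ G → g ≡ x ⊎ X g
      {is js} : List (Fin n)
      path→ : Path (Arc D) x is b
      path← : Path (Arc D) b js x
      uniq  : Unique (x ∷ is ++ b ∷ js)
      is-fresh : ∀ {h} → h ∈ is → X h × h ∉ G
      js-fresh : ∀ {h} → h ∈ js → X h × h ∉ G

  EarIn-mono : ∀ {X X′ x} → (∀ {v} → X v → X′ v) → EarIn X x → EarIn X′ x
  EarIn-mono X⊆ E = record
    { chain = chain ; G-in = [ inj₁ , inj₂ ∘ X⊆ ]′ ∘ G-in ; path→ = path→ ; path← = path←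
    ; uniq = uniq ; is-fresh = λ h∈ → X⊆ (proj₁ (is-fresh h∈)) , proj₂ (is-fresh h∈)
    ; js-fresh = λ h∈ → X⊆ (proj₁ (js-fresh h∈)) , proj₂ (js-fresh h∈) }
    where open EarIn E

  Coloured≤ : (Fin n → ℕ) → Fin n → Set
  Coloured≤ c v = c v ≤ k

  module ColourNext {c} (PC : PartialColouring D q k c) {x} (qx : T (q x)) (x≰k : ¬ c x ≤ k) where
    open PartialColouring PC

    -- The value `0` is reserved for `x` during the recolouring. Its class is a single vertex, hence
    -- acyclic because `D` has no loops.
    c₀ : Fin n → ℕ
    c₀ v = if does (v ≟ x) then 0 else c v

    c₀x : c₀ x ≡ 0
    c₀x with x ≟ x
    ... | yes _  = refl
    ... | no x≢x = contradiction refl x≢x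

    c₀≢ : ∀ {v} → v ≢ x → c₀ v ≡ c v
    c₀≢ {v} v≢x with v ≟ x
    ... | yes v≡x = contradiction v≡x v≢x
    ... | no _    = refl

    c₀≡0 : ∀ {v} → c₀ v ≡ 0 → v ≡ x
    c₀≡0 {v} eq with v ≟ x
    ... | yes v≡x = v≡x
    ... | no _ with () ← subst (1 ≤_) eq (positive v)

    c₀-acyclic : ∀ Y → IsDirectedCycle D Y → ∀ i → i ≤ k → ¬ All (λ y → c₀ y ≡ i) Y
    c₀-acyclic Y cyc zero    i≤k mono = constant-cycle loopless Y cyc x (c₀≡0 ∘ All.lookup mono)
    c₀-acyclic Y cyc (suc i) i≤k mono = acyclic Y cyc (suc i) i≤k (All.map undo mono)
      where
      undo : ∀ {y} → c₀ y ≡ suc i → c y ≡ suc i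
      undo {y} eq with y ≟ x
      ... | no _ = eq

    open From x
    open Coloured c₀ c₀x c₀≡0 c₀-acyclic

    c₀≤ : ∀ {v} → c₀ v ≤ k → v ≡ x ⊎ c v ≤ k
    c₀≤ {v} le with v ≟ x
    ... | yes v≡x = inj₁ v≡x
    ... | no _    = inj₂ le

    c₀≤⁻ : ∀ {v} → v ≢ x → c₀ v ≤ k → c v ≤ k
    c₀≤⁻ v≢x le = subst (_≤ k) (c₀≢ v≢x) le

    colourNext : (Σ (Fin n → ℕ) λ c′ → PartialColouring D q k c′ ×
                   (∀ v → c v ≤ k → c′ v ≤ k) × c′ x ≤ k) ⊎
                 EarIn (Coloured≤ c) x
    colourNext with recolour-or-ear
    ... | inj₁ record { c′ = c′ ; positive = pos ; inside = inside ; outside = outside ; acyclic′ = acyclic′ } =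
      inj₁ (c′ , record { positive = pos ; within = within′ ; acyclic = acyclic′ } ,
            (λ v c≤ → inside v (subst (_≤ k) (sym (c₀≢ λ { refl → x≰k c≤ })) c≤)) ,
            inside x (subst (_≤ k) (sym c₀x) z≤n))
      where
      within′ : ∀ v → c′ v ≤ k → T (q v)
      within′ v c′≤ with c₀ v ≤? k
      ... | no c₀≰ = contradiction (subst (_≤ k) (outside v c₀≰) c′≤) c₀≰
      ... | yes le with c₀≤ le
      ...   | inj₁ refl = qx
      ...   | inj₂ c≤   = within v c≤
    ... | inj₂ ear = inj₂ (record
      { chain = E.chain
      ; G-in = c₀≤ ∘ E.G≤
      ; path→ = E.path→
      ; path← = E.path←
      ; uniq = E.uniq
      ; is-fresh = λ h∈ → c₀≤⁻ (λ { refl → x∉ (∈-++⁺ˡ h∈) }) (proj₁ (E.is-fresh h∈)) ,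
                          proj₂ (E.is-fresh h∈)
      ; js-fresh = λ h∈ → c₀≤⁻ (λ { refl → x∉ (∈-++⁺ʳ E.is (there h∈)) }) (proj₁ (E.js-fresh h∈)) ,
                          proj₂ (E.js-fresh h∈) })
      where
      module E = Ear ear
      x∉ : x ∉ E.is ++ E.b ∷ E.js
      x∉ = proj₁ (Unique-∷⁻ E.uniq)

  record Saturated (c : Fin n → ℕ) (xs : List (Fin n)) : Set where
    field
      colouring : PartialColouring D q k c
      ears      : ∀ {x} → x ∈ xs → T (q x) → c x ≤ k ⊎ EarIn (Coloured≤ c) x

  -- One pass is enough. Colours may change later, but the set of coloured vertices only grows, so
  -- an ear recorded for a rejected vertex stays valid.
  saturate : ∀ xs → ∃[ c ] Saturated c xs
  saturate [] = (λ _ → suc k) , record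
    { colouring = record
      { positive = λ _ → s≤s z≤n
      ; within = λ _ le → contradiction le (ℕₚ.<-irrefl refl)
      ; acyclic = λ { (y ∷ Y) _ i i≤k (eq ∷ _) → ℕₚ.<-irrefl (sym eq) (s≤s i≤k) } }
    ; ears = λ () }
  saturate (x ∷ xs) with saturate xs
  ... | c , sat with c x ≤? k | T? (q x)
  ...   | yes c≤ | _ = c , record { Saturated sat ; ears = λ
            { (here refl) _ → inj₁ c≤ ; (there y∈) → Saturated.ears sat y∈ } }
  ...   | no _ | no ¬qx = c , record { Saturated sat ; ears = λ
            { (here refl) qx → contradiction qx ¬qx ; (there y∈) → Saturated.ears sat y∈ } }
  ...   | no c≰ | yes qx with ColourNext.colourNext (Saturated.colouring sat) qx c≰
  ...     | inj₂ ear = c , record { Saturated sat ; ears = λ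
            { (here refl) _ → inj₂ ear ; (there y∈) → Saturated.ears sat y∈ } }
  ...     | inj₁ (c′ , PC , mono , c′x) = c′ , record { colouring = PC ; ears = λ
            { (here refl) _ → inj₁ c′x
            ; (there y∈) qy → [ inj₁ ∘ mono _ , inj₂ ∘ EarIn-mono (mono _) ]′
                                (Saturated.ears sat y∈ qy) } }

  record Reserved (m : ℕ) : Set₁ where
    field
      q′      : Fin n → Bool
      q′⊆     : ∀ {v} → T (q′ v) → T (q v)
      atLeast : AtLeastOn D q′ m
      X       : Fin n → Set
      X⊆      : ∀ {v} → X v → T (q v)
      X∩q′    : ∀ {v} → X v → ¬ T (q′ v)
      ear     : ∀ {x} → T (q′ x) → EarIn X x

  -- A colouring of the uncoloured rest with fewer than `m` colours, stacked on the `k` colours of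
  -- the saturated set, would colour all of `q` with fewer than `k + m`.
  reserve : ∀ {m} → AtLeastOn D q (k + m) → Reserved m
  reserve {m} χ with saturate (allFin n)
  ... | c , record { colouring = PC ; ears = ears } = record
    { q′ = q′
    ; q′⊆ = λ t → proj₁ (q′⁻ t)
    ; atLeast = λ j j<m col → χ (k + j) (ℕₚ.+-monoʳ-< k j<m) (combine col)
    ; X = Coloured≤ c
    ; X⊆ = within _
    ; X∩q′ = λ Xv q′v → proj₂ (q′⁻ q′v) Xv
    ; ear = λ t → let (qx , c≰) = q′⁻ t in
                  [ (λ c≤ → contradiction c≤ c≰) , id ]′ (ears (∈-allFin _) qx) }
    where
    open PartialColouring PC
    q′ : Fin n → Bool
    q′ v = q v ∧ not (does (c v ≤? k))
    q′⁻ : ∀ {v} → T (q′ v) → T (q v) × ¬ c v ≤ k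
    q′⁻ {v} t = let (qv , ¬c≤) = T-diff⁻ t in qv , ¬c≤ ∘ T-does⁺ {d = c v ≤? k}
    q′⁺ : ∀ {v} → T (q v) → ¬ c v ≤ k → T (q′ v)
    q′⁺ {v} qv c≰ = T-diff⁺ qv (c≰ ∘ T-does⁻ {d = c v ≤? k})
    combine : ∀ {j} → ColourableOn D q′ j → ColourableOn D q (k + j)
    combine {j} (c₂ , c₂< , acyclic₂) = d , d< , d-acyclic
      where
      d : Fin n → ℕ
      d v with c v ≤? k
      -- Colours `1` to `k` are shifted down by one, so that the rest can start at `k`.
      ... | yes _ = pred (c v)
      ... | no _  = k + c₂ v
      d< : ∀ v → T (q v) → d v < k + j
      d< v qv with c v ≤? k
      ... | yes c≤ = ℕₚ.≤-trans (ℕₚ.≤-trans (ℕₚ.≤-reflexive (pred-suc (positive v))) c≤) (ℕₚ.m≤m+n k j)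
        where
        pred-suc : ∀ {i} → 1 ≤ i → suc (pred i) ≡ i
        pred-suc (s≤s _) = refl
      ... | no c≰  = ℕₚ.+-monoʳ-< k (c₂< v (q′⁺ qv c≰))
      low : ∀ {v i} → i < k → d v ≡ i → c v ≡ suc i
      low {v} i<k eq with c v ≤? k
      ... | yes _ with c v | positive v
      ...   | suc _ | _ = cong suc eq
      low {v} i<k eq | no _ = contradiction i<k (ℕₚ.≤⇒≯ (subst (k ≤_) eq (ℕₚ.m≤m+n k (c₂ v))))
      high : ∀ {v i} → d v ≡ k + i → ¬ c v ≤ k × c₂ v ≡ i
      high {v} {i} eq with c v ≤? k
      ... | no c≰ = c≰ , ℕₚ.+-cancelˡ-≡ k _ _ eq
      ... | yes c≤ with c v | positive v
      ...   | suc a | _ = contradiction (subst (_< k) eq c≤) (ℕₚ.≤⇒≯ (ℕₚ.m≤m+n k i))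
      d-acyclic : ∀ Y → IsDirectedCycle D Y → All (T ∘ q) Y → ∀ i → ¬ All (λ y → d y ≡ i) Y
      d-acyclic Y cyc inq i mono with i <? k
      ... | yes i<k = acyclic Y cyc (suc i) i<k (All.map (low i<k) mono)
      ... | no i≮k with ℕₚ.m≤n⇒∃[o]m+o≡n (ℕₚ.≮⇒≥ i≮k)
      ...   | i′ , refl = acyclic₂ Y cyc
              (All.zipWith (λ (qy , eq) → q′⁺ qy (proj₁ (high eq))) (inq , mono)) i′
              (All.map (proj₂ ∘ high) mono)

-- Subdivisions of induced subpatterns

-- A subdivision, inside the region `R`, of the subpattern induced by `p`. The maps are total but
-- constrained only on `p`, so vertices can be added without changing the vertex type.
record Embedding {N n} (H : Digraph N) (p : Fin N → Bool) (D : Digraph n) (R : Fin n → Set) : Set where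
  field
    φ      : Fin N → Fin n
    φ-inj  : ∀ {u v} → T (p u) → T (p v) → φ u ≡ φ v → u ≡ v
    φ∈R    : ∀ {u} → T (p u) → R (φ u)
    P      : Fin N → Fin N → List (Fin n)
    P-path : ∀ {u v} → T (p u) → T (p v) → Arc H u v → Path (Arc D) (φ u) (P u v) (φ v)
    P-uniq : ∀ {u v} → T (p u) → T (p v) → Arc H u v → Unique (P u v)
    P⊆R    : ∀ {u v} → T (p u) → T (p v) → Arc H u v → ∀ {h} → h ∈ P u v → R h
    P-avoid : ∀ {u v w} → T (p u) → T (p v) → Arc H u v → T (p w) → φ w ∉ P u v
    P-disj : ∀ {u v u′ v′} → T (p u) → T (p v) → Arc H u v →
             T (p u′) → T (p v′) → Arc H u′ v′ → ¬ (u ≡ u′ × v ≡ v′) →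
             ∀ {h} → h ∈ P u v → h ∉ P u′ v′

Embedding-mono : ∀ {N n} {H : Digraph N} {p} {D : Digraph n} {R R′ : Fin n → Set} →
                 (∀ {v} → R v → R′ v) → Embedding H p D R → Embedding H p D R′
Embedding-mono R⊆ E = record
  { φ = φ ; φ-inj = φ-inj ; φ∈R = R⊆ ∘ φ∈R ; P = P ; P-path = P-path ; P-uniq = P-uniq
  ; P⊆R = λ u v a → R⊆ ∘ P⊆R u v a ; P-avoid = P-avoid ; P-disj = P-disj }
  where open Embedding E

Embedding-pull : ∀ {M N n} {F : Digraph M} {H : Digraph N} {p p′} {D : Digraph n} {R : Fin n → Set}
  (g : Fin M → Fin N) → (∀ {u v} → T (p u) → T (p v) → g u ≡ g v → u ≡ v) →
  (∀ {u} → T (p u) → T (p′ (g u))) →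
  (∀ {u v} → T (p u) → T (p v) → Arc F u v → Arc H (g u) (g v)) →
  Embedding H p′ D R → Embedding F p D R
Embedding-pull g g-inj g∈ g-arc E = record
  { φ = φ ∘ g
  ; φ-inj = λ pu pv eq → g-inj pu pv (φ-inj (g∈ pu) (g∈ pv) eq)
  ; φ∈R = φ∈R ∘ g∈
  ; P = λ u v → P (g u) (g v)
  ; P-path = λ pu pv a → P-path (g∈ pu) (g∈ pv) (g-arc pu pv a)
  ; P-uniq = λ pu pv a → P-uniq (g∈ pu) (g∈ pv) (g-arc pu pv a)
  ; P⊆R = λ pu pv a → P⊆R (g∈ pu) (g∈ pv) (g-arc pu pv a)
  ; P-avoid = λ pu pv a pw → P-avoid (g∈ pu) (g∈ pv) (g-arc pu pv a) (g∈ pw)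
  ; P-disj = λ pu pv a pu′ pv′ a′ ≢ →
      P-disj (g∈ pu) (g∈ pv) (g-arc pu pv a) (g∈ pu′) (g∈ pv′) (g-arc pu′ pv′ a′)
             (λ (eq , eq′) → ≢ (g-inj pu pu′ eq , g-inj pv pv′ eq′)) }
  where open Embedding E

open Walks using (Step)

-- In contrast to `Path (Step σ)`, the internal list follows the direction of the arcs, as a
-- subdivision demands.
Walk : ∀ {n} → Digraph n → Sign → Fin n → List (Fin n) → Fin n → Set
Walk D out  a I w = Path (Arc D) a I w
Walk D into a I w = Path (Arc D) w I a

-- The old subdivision lies in `R`, while `y` and the lists `L` avoid `R`; disjointness from
-- everything placed before follows. In `L σ u` the sign tells whether the arc runs from `u` to `v`
-- or back.
module AddVertex {N n} {H : Digraph N} {p : Fin N → Bool} {D : Digraph n} {R R′ : Fin n → Set}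
  (E : Embedding H p D R) (v : Fin N) (v∉p : ¬ T (p v)) (no-loop : ¬ Arc H v v)
  (R⊆R′ : ∀ {h} → R h → R′ h) {y : Fin n} (y∉R : ¬ R y) (y∈R′ : R′ y)
  (L : Sign → Fin N → List (Fin n))
  (L-walk  : ∀ σ {u} → T (p u) → Step H σ u v → Walk D σ (Embedding.φ E u) (L σ u) y)
  (L-uniq  : ∀ σ {u} → T (p u) → Step H σ u v → Unique (y ∷ L σ u))
  (L-fresh : ∀ σ {u} → T (p u) → Step H σ u v → ∀ {h} → h ∈ L σ u → R′ h × ¬ R h)
  (L-disj  : ∀ σ σ′ {u u′} → T (p u) → Step H σ u v → T (p u′) → Step H σ′ u′ v →
             ¬ (σ ≡ σ′ × u ≡ u′) → ∀ {h} → h ∈ L σ u → h ∉ L σ′ u′)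
  where

  open Embedding E

  p⁺ : Fin N → Bool
  p⁺ = insert v p

  φ⁺ : Fin N → Fin n
  φ⁺ u = if does (u ≟ v) then y else φ u

  P⁺ : Fin N → Fin N → List (Fin n)
  P⁺ u w = if does (u ≟ v) then L into w else if does (w ≟ v) then L out u else P u w

  φ⁺-new : φ⁺ v ≡ y
  φ⁺-new with v ≟ v
  ... | yes _  = refl
  ... | no v≢v = contradiction refl v≢v

  φ⁺-old : ∀ {u} → u ≢ v → φ⁺ u ≡ φ u
  φ⁺-old {u} u≢v with u ≟ v
  ... | yes u≡v = contradiction u≡v u≢v
  ... | no _    = refl

  old≢ : ∀ {u} → T (p u) → u ≢ v
  old≢ pu refl = v∉p pu

  data Vertex : Fin N → Set where
    new : Vertex v
    old : ∀ {u} → T (p u) → Vertex u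

  vertex : ∀ {u} → T (p⁺ u) → Vertex u
  vertex {u} t with T-∨⁻ (does (u ≟ v)) t
  ... | inj₁ t′ with refl ← T-does⁻ {d = u ≟ v} t′ = new
  ... | inj₂ pu = old pu

  data Connection : Fin N → Fin N → List (Fin n) → Set where
    to-new   : ∀ {u} → T (p u) → Step H out u v → Connection u v (L out u)
    from-new : ∀ {u} → T (p u) → Step H into u v → Connection v u (L into u)
    within   : ∀ {u w} → T (p u) → T (p w) → Arc H u w → Connection u w (P u w)

  connection : ∀ {u w} → T (p⁺ u) → T (p⁺ w) → Arc H u w → Connection u w (P⁺ u w)
  connection {u} {w} tu tw a with vertex tu | vertex tw
  ... | new    | new    = contradiction a no-loop
  ... | new    | old pw with v ≟ v
  ...   | yes _  = from-new pw a
  ...   | no v≢v = contradiction refl v≢v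
  connection {u} {w} tu tw a | old pu | new with u ≟ v | v ≟ v
  ...   | yes u≡v | _      = contradiction u≡v (old≢ pu)
  ...   | no _    | yes _  = to-new pu a
  ...   | no _    | no v≢v = contradiction refl v≢v
  connection {u} {w} tu tw a | old pu | old pw with u ≟ v | w ≟ v
  ...   | yes u≡v | _       = contradiction u≡v (old≢ pu)
  ...   | no _    | yes w≡v = contradiction w≡v (old≢ pw)
  ...   | no _    | no _    = within pu pw a

  φ⁺-vertex : ∀ {u} → Vertex u → R′ (φ⁺ u)
  φ⁺-vertex new      = subst R′ (sym φ⁺-new) y∈R′
  φ⁺-vertex (old pu) = subst R′ (sym (φ⁺-old (old≢ pu))) (R⊆R′ (φ∈R pu))

  avoidNew : ∀ {w} σ {u} → Vertex w → T (p u) → Step H σ u v → φ⁺ w ∉ L σ u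
  avoidNew σ new      pu a φw∈ = proj₁ (Unique-∷⁻ (L-uniq σ pu a)) (subst (_∈ _) φ⁺-new φw∈)
  avoidNew σ (old pw) pu a φw∈ =
    proj₂ (L-fresh σ pu a (subst (_∈ _) (φ⁺-old (old≢ pw)) φw∈)) (φ∈R pw)

  avoid : ∀ {w u z I} → Vertex w → Connection u z I → φ⁺ w ∉ I
  avoid w (to-new pu a)   = avoidNew out w pu a
  avoid w (from-new pu a) = avoidNew into w pu a
  avoid new      (within pu pz a) φw∈ = y∉R (P⊆R pu pz a (subst (_∈ _) φ⁺-new φw∈))
  avoid (old pw) (within pu pz a) φw∈ =
    P-avoid pu pz a pw (subst (_∈ _) (φ⁺-old (old≢ pw)) φw∈)

  disj : ∀ {u w u′ w′ I I′} → Connection u w I → Connection u′ w′ I′ →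
         ¬ (u ≡ u′ × w ≡ w′) → ∀ {h} → h ∈ I → h ∉ I′
  disj (to-new pu a)    (to-new pu′ a′)   ≢ = L-disj out out pu a pu′ a′ λ { (_ , refl) → ≢ (refl , refl) }
  disj (to-new pu a)    (from-new pu′ a′) ≢ = L-disj out into pu a pu′ a′ λ ()
  disj (from-new pu a)  (to-new pu′ a′)   ≢ = L-disj into out pu a pu′ a′ λ ()
  disj (from-new pu a)  (from-new pu′ a′) ≢ = L-disj into into pu a pu′ a′ λ { (_ , refl) → ≢ (refl , refl) }
  disj (to-new pu a)    (within pu′ pw′ a′) ≢ h∈ = proj₂ (L-fresh out pu a h∈) ∘ P⊆R pu′ pw′ a′
  disj (from-new pu a)  (within pu′ pw′ a′) ≢ h∈ = proj₂ (L-fresh into pu a h∈) ∘ P⊆R pu′ pw′ a′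
  disj (within pu pw a) (to-new pu′ a′)   ≢ h∈ h∈′ = proj₂ (L-fresh out pu′ a′ h∈′) (P⊆R pu pw a h∈)
  disj (within pu pw a) (from-new pu′ a′) ≢ h∈ h∈′ = proj₂ (L-fresh into pu′ a′ h∈′) (P⊆R pu pw a h∈)
  disj (within pu pw a) (within pu′ pw′ a′) ≢ = P-disj pu pw a pu′ pw′ a′ ≢

  path : ∀ {u w I} → Connection u w I → Path (Arc D) (φ⁺ u) I (φ⁺ w)
  path {u} {_} {I} (to-new pu a) =
    subst (λ b → Path _ b I (φ⁺ v)) (sym (φ⁺-old (old≢ pu)))
      (subst (Path _ (φ u) I) (sym φ⁺-new) (L-walk out pu a))
  path {_} {w} {I} (from-new pw a) =
    subst (Path _ (φ⁺ v) I) (sym (φ⁺-old (old≢ pw)))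
      (subst (λ b → Path _ b I (φ w)) (sym φ⁺-new) (L-walk into pw a))
  path {u} {w} {I} (within pu pw a) =
    subst (λ b → Path _ b I (φ⁺ w)) (sym (φ⁺-old (old≢ pu)))
      (subst (Path _ (φ u) I) (sym (φ⁺-old (old≢ pw))) (P-path pu pw a))

  uniq : ∀ {u w I} → Connection u w I → Unique I
  uniq (to-new pu a)    = proj₂ (Unique-∷⁻ (L-uniq out pu a))
  uniq (from-new pu a)  = proj₂ (Unique-∷⁻ (L-uniq into pu a))
  uniq (within pu pw a) = P-uniq pu pw a

  inside : ∀ {u w I} → Connection u w I → ∀ {h} → h ∈ I → R′ h
  inside (to-new pu a)    h∈ = proj₁ (L-fresh out pu a h∈)
  inside (from-new pu a)  h∈ = proj₁ (L-fresh into pu a h∈)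
  inside (within pu pw a) h∈ = R⊆R′ (P⊆R pu pw a h∈)

  inj : ∀ {u w} → Vertex u → Vertex w → φ⁺ u ≡ φ⁺ w → u ≡ w
  inj new      new      eq = refl
  inj new      (old pw) eq =
    contradiction (subst R (trans (sym (φ⁺-old (old≢ pw))) (trans (sym eq) φ⁺-new)) (φ∈R pw)) y∉R
  inj (old pu) new      eq =
    contradiction (subst R (trans (sym (φ⁺-old (old≢ pu))) (trans eq φ⁺-new)) (φ∈R pu)) y∉R
  inj (old pu) (old pw) eq =
    φ-inj pu pw (trans (sym (φ⁺-old (old≢ pu))) (trans eq (φ⁺-old (old≢ pw))))

  extended : Embedding H p⁺ D R′
  extended = record
    { φ = φ⁺
    ; φ-inj = λ pu pw → inj (vertex pu) (vertex pw)
    ; φ∈R = φ⁺-vertex ∘ vertex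
    ; P = P⁺
    ; P-path = λ pu pw a → path (connection pu pw a)
    ; P-uniq = λ pu pw a → uniq (connection pu pw a)
    ; P⊆R = λ pu pw a → inside (connection pu pw a)
    ; P-avoid = λ pu pw a pz → avoid (vertex pz) (connection pu pw a)
    ; P-disj = λ pu pw a pu′ pw′ a′ → disj (connection pu pw a) (connection pu′ pw′ a′) }

-- The induction works with this statement for subsets `p` of the pattern and `q` of the host. Since
-- `φ` is total and `D` may have no vertices, `p` must be nonempty.
Forced : ∀ {N} → Digraph N → (Fin N → Bool) → Set
Forced H p = ∀ {n} (D : Digraph n) → Loopless D → (q : Fin n → Bool) → ∃ (T ∘ p) →
             AtLeastOn D q (count p) → Embedding H p D (T ∘ q)

-- Injectivity is asked on `p` alone, so `g` may collapse what lies outside, as a projection to one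
-- part of the pattern does.
Forced-pull : ∀ {M N} {F : Digraph M} {H : Digraph N} {p p′} (g : Fin M → Fin N) →
  (∀ {u v} → T (p u) → T (p v) → g u ≡ g v → u ≡ v) →
  (∀ {u} → T (p u) → T (p′ (g u))) →
  (∀ {u v} → T (p u) → T (p v) → Arc F u v → Arc H (g u) (g v)) →
  count p′ ≤ count p → Forced H p′ → Forced F p
Forced-pull g g-inj g∈ g-arc count≤ forced D ll q (u , pu) χ =
  Embedding-pull g g-inj g∈ g-arc (forced D ll q (g u , g∈ pu) (AtLeastOn-mono count≤ χ))

Forced-resp : ∀ {N} {H : Digraph N} {p p′} → (∀ {u} → T (p u) → T (p′ u)) →
  (∀ {u} → T (p′ u) → T (p u)) → Forced H p′ → Forced H p
Forced-resp {p = p} {p′} p⊆ ⊆p =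
  Forced-pull id (λ _ _ → id) p⊆ (λ _ _ → id) (count-mono {p = p′} {q = p} λ _ → ⊆p)

nonempty : ∀ {n} {D : Digraph n} {q m} → AtLeastOn D q (suc m) → ∃ (T ∘ q)
nonempty {q = q} χ with any? (T? ∘ q)
... | yes some = some
... | no none  = contradiction
      ((λ _ → 0) , (λ v qv → contradiction (v , qv) none) ,
       λ { (y ∷ _) _ (qy ∷ _) → contradiction (y , qy) none }) (χ 0 (s≤s z≤n))

Forced-empty : ∀ {N} {H : Digraph N} {p} → (∀ u → ¬ T (p u)) → Forced H p
Forced-empty none D ll q (u , pu) = contradiction pu (none u)

-- Every vertex outside a maximal acyclic set closes a directed cycle with it.
Forced-pendant : ∀ {N} {H : Digraph N} {p} v → ¬ T (p v) → ¬ Arc H v v →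
  (∀ {u u′ σ σ′} → T (p u) → Step H σ u v → T (p u′) → Step H σ′ u′ v → u ≡ u′) →
  Forced H p → Forced H (insert v p)
Forced-pendant {H = H} {p} v v∉p no-loop single-nbr forced D ll q _ χ with any? (T? ∘ p)
-- With no earlier vertex there are no paths to find, and any vertex of `q` can represent `v`.
... | no none = AddVertex.extended {R′ = T ∘ q} empty v v∉p no-loop (λ ()) (λ ())
      (proj₂ some) (λ _ _ → []) (λ _ pu → contradiction (_ , pu) none)
      (λ _ pu → contradiction (_ , pu) none) (λ _ pu → contradiction (_ , pu) none)
      (λ _ _ pu → contradiction (_ , pu) none)
  where
  some : ∃ (T ∘ q)
  some = nonempty (AtLeastOn-mono (ℕₚ.≤-reflexive (sym (count-insert v v∉p))) χ)
  empty : Embedding H p D (λ _ → ⊥)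
  empty = record
    { φ = λ _ → proj₁ some
    ; φ-inj = λ pu → contradiction (_ , pu) none
    ; φ∈R = λ pu → none (_ , pu)
    ; P = λ _ _ → []
    ; P-path = λ pu → contradiction (_ , pu) none
    ; P-uniq = λ pu → contradiction (_ , pu) none
    ; P⊆R = λ pu → contradiction (_ , pu) none
    ; P-avoid = λ pu → contradiction (_ , pu) none
    ; P-disj = λ pu → contradiction (_ , pu) none }
... | yes nonempty-p = result
  where
  -- With `k₁ = 0` a single colour is reserved, so `X` is an acyclic set. The closing paths of an
  -- ear form a directed cycle through its root and `b`, and `b` becomes the image of `v`.
  open Reserve D ll q 0 (λ _ → single out) out refl (λ _ ())
  open Reserved (reserve (AtLeastOn-mono (ℕₚ.≤-reflexive (sym (count-insert v v∉p))) χ))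
  E : Embedding H p D (T ∘ q′)
  E = forced D ll q′ nonempty-p atLeast
  open Embedding E using (φ; φ∈R)

  attach : ∀ {u} → T (p u) → (∀ {u′ σ} → T (p u′) → Step H σ u′ v → u′ ≡ u) →
           Embedding H (insert v p) D (T ∘ q)
  attach {u} pu only = AddVertex.extended E v v∉p no-loop q′⊆
      (X∩q′ b∈X) (X⊆ b∈X) L
      walk uniqL
      (λ { out _ _ h∈ → fresh (proj₁ (is-fresh h∈)) ; into _ _ h∈ → fresh (proj₁ (js-fresh h∈)) })
      disj
    where
    open EarIn (ear (φ∈R pu))
    b≢φu : b ≢ φ u
    b≢φu eq = proj₁ (Unique-∷⁻ uniq) (∈-++⁺ʳ is (here (sym eq)))
    b∈X : X b
    b∈X = [ (λ eq → contradiction eq b≢φu) , id ]′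
          (G-in (Rooted.From.tip∈ D 0 _ out refl _ (φ u) chain))
    L : Sign → Fin _ → List (Fin _)
    L out  _ = is
    L into _ = js
    fresh : ∀ {h} → X h → T (q h) × ¬ T (q′ h)
    fresh Xh = X⊆ Xh , X∩q′ Xh
    walk : ∀ σ {u′} → T (p u′) → Step H σ u′ v → Walk D σ (φ u′) (L σ u′) b
    walk out  pu′ a with refl ← only {σ = out} pu′ a = path→
    walk into {u′} pu′ a with refl ← only {σ = into} pu′ a = path←
    parts = Unique-++⁻ is (proj₂ (Unique-∷⁻ uniq))
    uniqL : ∀ σ {u′} → T (p u′) → Step H σ u′ v → Unique (b ∷ L σ u′)
    uniqL out  _ _ = Unique-∷⁺ (λ b∈ → proj₂ (proj₂ parts) b∈ (here refl)) (proj₁ parts)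
    uniqL into _ _ = proj₁ (proj₂ parts)
    disj : ∀ σ σ′ {u u′} → T (p u) → Step H σ u v → T (p u′) → Step H σ′ u′ v →
           ¬ (σ ≡ σ′ × u ≡ u′) → ∀ {h} → h ∈ L σ u → h ∉ L σ′ u′
    disj out  out  pu a pu′ a′ ≢ = contradiction (refl , single-nbr {σ = out} {σ′ = out} pu a pu′ a′) ≢
    disj into into pu a pu′ a′ ≢ = contradiction (refl , single-nbr {σ = into} {σ′ = into} pu a pu′ a′) ≢
    disj out  into _ _ _ _ _ h∈ h∈′ = proj₂ (proj₂ parts) h∈ (there h∈′)
    disj into out  _ _ _ _ _ h∈ h∈′ = proj₂ (proj₂ parts) h∈′ (there h∈)

  neighbour? : Dec (∃[ u ] T (p u) × (Arc H u v ⊎ Arc H v u))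
  neighbour? = any? λ u → T? (p u) ×-dec (T? (arc H u v) ⊎-dec T? (arc H v u))

  result : Embedding H (insert v p) D (T ∘ q)
  result with neighbour?
  ... | yes (u , pu , inj₁ a) = attach pu λ {_} {σ} pu′ a′ → single-nbr {σ = σ} {σ′ = out} pu′ a′ pu a
  ... | yes (u , pu , inj₂ a) = attach pu λ {_} {σ} pu′ a′ → single-nbr {σ = σ} {σ′ = into} pu′ a′ pu a
  -- An isolated `v` may be attached at any vertex of `p`, as no path is then demanded.
  ... | no none = attach (proj₂ nonempty-p) λ
        { {_} {out} pu′ a → contradiction (_ , pu′ , inj₁ a) none
        ; {_} {into} pu′ a → contradiction (_ , pu′ , inj₂ a) none }

-- Attaching an ear

-- If neither arc is present the kind is an arbitrary single one: the pattern asks for no path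
-- there.
kindOf : Bool → Bool → Kind
kindOf true  true  = double
kindOf true  false = single out
kindOf false true  = single into
kindOf false false = single out

bit : Sign → Bool → Bool → Bool
bit out  a b = a
bit into a b = b

module LinkLists {n} (D : Digraph n) (k₁ : ℕ) (e : ℕ → Kind) (s : Sign)
  (e-last : e (suc k₁) ≡ single s)
  (e-sep : ∀ j → e (suc j) ≡ double → ∃[ σ ] e j ≡ single σ) where

  open Rooted D k₁ e s e-last e-sep

  -- Splits a link into the internal lists of its two possible directions. An `into` path was
  -- recorded from the root outwards and is reversed here; a direction that the link lacks gets the
  -- empty list.
  lists : ∀ {K a I w} → Link K a I w → Sign → List (Fin n)
  lists (single {out}  {I = I} p) out  = I
  lists (single {out}          p) into = []
  lists (single {into}         p) out  = []
  lists (single {into} {I = I} p) into = reverse I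
  lists (double {I = I} p q)      out  = I
  lists (double {J = J} p q)      into = J

  lists-walk : ∀ α β {K a I w} (l : Link K a I w) → K ≡ kindOf α β →
               ∀ σ → T (bit σ α β) → Walk D σ a (lists l σ) w
  lists-walk true  true  (double p q)      _ out  _ = p
  lists-walk true  true  (double p q)      _ into _ = q
  lists-walk true  false (single {out} p)  _ out  _ = p
  lists-walk false true  (single {into} p) _ into _ = reversePath p
  lists-walk false false l _ out  ()
  lists-walk false false l _ into ()
  lists-walk true  true  (single p) ()
  lists-walk true  false (double p q) ()
  lists-walk false true  (double p q) ()
  lists-walk true  false (single {into} p) ()
  lists-walk false true  (single {out} p) ()

  lists⊆ : ∀ {K a I w} (l : Link K a I w) σ {h} → h ∈ lists l σ → h ∈ I
  lists⊆ (single {out}  p) out  h∈ = h∈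
  lists⊆ (single {into} p) into h∈ = reverse⁻ h∈
  lists⊆ (double p q)      out  h∈ = ∈-++⁺ˡ h∈
  lists⊆ (double {I = I} p q) into h∈ = ∈-++⁺ʳ I h∈

  lists-uniq : ∀ {K a I w} (l : Link K a I w) → Unique (w ∷ I) → ∀ σ → Unique (w ∷ lists l σ)
  lists-uniq l u σ with Unique-∷⁻ u
  ... | w∉ , uI = Unique-∷⁺ (w∉ ∘ lists⊆ l σ) (uniq l σ uI)
    where
    uniq : ∀ {K a I w} (l : Link K a I w) σ → Unique I → Unique (lists l σ)
    uniq (single {out}  p) out  u = u
    uniq (single {out}  p) into u = []
    uniq (single {into} p) out  u = []
    uniq (single {into} p) into u = Unique-reverse u
    uniq (double {I = I} p q) out  u = proj₁ (Unique-++⁻ I u)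
    uniq (double {I = I} p q) into u = proj₁ (proj₂ (Unique-++⁻ I u))

  lists-disj : ∀ {K a I w} (l : Link K a I w) → Unique I → ∀ σ σ′ → σ ≢ σ′ →
               ∀ {h} → h ∈ lists l σ → h ∉ lists l σ′
  lists-disj l u out  out  ≢ = contradiction refl ≢
  lists-disj l u into into ≢ = contradiction refl ≢
  lists-disj (single {out}  p) u out  into ≢ _  ()
  lists-disj (single {into} p) u out  into ≢ ()
  lists-disj (single {out}  p) u into out  ≢ ()
  lists-disj (single {into} p) u into out  ≢ _  ()
  lists-disj (double {I = I} p q) u out  into ≢ h∈ h∈′ = proj₂ (proj₂ (Unique-++⁻ I u)) h∈ h∈′
  lists-disj (double {I = I} p q) u into out  ≢ h∈ h∈′ = proj₂ (proj₂ (Unique-++⁻ I u)) h∈′ h∈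

-- The pattern H restricted to p₀ together with the path v 0, v 1, …, v k, whose
-- last vertex is moreover adjacent to v 0.
module EarPattern {N} (H : Digraph N) (p₀ : Fin N → Bool) (κ : ℕ) (v : ℕ → Fin N) where

  k₁ k : ℕ
  k₁ = suc κ
  k  = suc k₁

  ext : ℕ → Fin N → Bool
  ext zero    = p₀
  ext (suc i) = insert (v (suc i)) (ext i)

  kind : ℕ → Kind
  -- Links are numbered from `1`. A single placeholder makes the separation condition hold at the
  -- root.
  kind zero    = single out
  kind (suc i) = kindOf (arc H (v i) (v (suc i))) (arc H (v (suc i)) (v i))

  module _
    (v₀∈ : T (p₀ (v 0)))
    (v∉ : ∀ i → i < k → ¬ T (ext i (v (suc i))))
    (no-loop : ∀ i → i < k → ¬ Arc H (v (suc i)) (v (suc i)))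
    (adj : ∀ i σ {u} → i < k₁ → T (ext i u) → Step H σ u (v (suc i)) → u ≡ v i)
    (adj-last : ∀ σ {u} → T (ext k₁ u) → Step H σ u (v k) → u ≡ v k₁ ⊎ u ≡ v 0)
    (vk₁≢v₀ : v k₁ ≢ v 0)
    (s : Sign) (kind-last : kind k ≡ single s)
    (kind-sep : ∀ j → kind (suc j) ≡ double → ∃[ σ ] kind j ≡ single σ)
    where

    count-ext : ∀ i → i ≤ k → count (ext i) ≡ i + count p₀
    count-ext zero    _   = refl
    count-ext (suc i) i<k =
      trans (count-insert (v (suc i)) (v∉ i i<k)) (cong suc (count-ext i (ℕₚ.<⇒≤ i<k)))

    module Embed {n} {D : Digraph n} {x : Fin n} {R : Fin n → Set}
      (E₀ : Embedding H p₀ D R) (φv₀ : Embedding.φ E₀ (v 0) ≡ x) where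

      open Rooted D k₁ kind s kind-last kind-sep using (Link; module From)
      open From x
      open LinkLists D k₁ kind s kind-last kind-sep

      root∈ : ∀ {j w C} → Chain j w C → x ∈ C
      root∈ root = here refl
      root∈ (link {I = I} ch _ _ _) = there (∈-++⁺ʳ I (root∈ ch))

      Placed : ∀ {j R′} (w : Fin n) → Embedding H (ext j) D R′ → Set
      Placed {j} w E = Embedding.φ E (v j) ≡ w × Embedding.φ E (v 0) ≡ x

      walk : ∀ {j a I w a′} (l : Link (kind (suc j)) a I w) → a′ ≡ a →
             ∀ σ {u} → u ≡ v j → Step H σ u (v (suc j)) → Walk D σ a′ (lists l σ) w
      walk {j} l refl out  refl a = lists-walk _ _ l refl out a
      walk {j} l refl into refl a =
        lists-walk (arc H (v j) (v (suc j))) (arc H (v (suc j)) (v j)) l refl into a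

      -- The chain meets the region of `E₀` in `x` alone. So its links can be added one by one, the
      -- occupied region being `R` together with the chain so far.
      build : ∀ {j w C} → j ≤ k₁ → Chain j w C → (∀ {h} → h ∈ C → h ≡ x ⊎ ¬ R h) →
              Σ (Embedding H (ext j) D (λ h → R h ⊎ h ∈ C)) (Placed {j} w)
      build _ root _ = Embedding-mono inj₁ E₀ , φv₀ , φv₀
      build {suc j} {w} {C} j<k₁ (link {G = C₀} {I = I} ch l uI dis) C-new
        with build (ℕₚ.<⇒≤ j<k₁) ch (C-new ∘ there ∘ ∈-++⁺ʳ I)
      ... | E , φj , φ0 = A.extended , A.φ⁺-new ,
            trans (A.φ⁺-old λ eq → v∉ j j<k (subst (T ∘ ext j) eq (v₀∈ext j))) φ0
        where
        j<k : j < k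
        j<k = ℕₚ.m≤n⇒m≤1+n j<k₁
        v₀∈ext : ∀ i → T (ext i (v 0))
        v₀∈ext zero    = v₀∈
        v₀∈ext (suc i) = T-∨⁺ʳ (does (v 0 ≟ v (suc i))) (v₀∈ext i)
        fresh : ∀ {h} → h ∈ w ∷ I → ¬ (R h ⊎ h ∈ C₀)
        fresh h∈ (inj₂ h∈C₀) = dis h∈ h∈C₀
        fresh h∈ (inj₁ Rh) with C-new (∈-++⁺ˡ h∈)
        ... | inj₁ refl = dis h∈ (root∈ ch)
        ... | inj₂ ¬Rh  = ¬Rh Rh
        L-disj : ∀ σ σ′ {u u′} → T (ext j u) → Step H σ u (v (suc j)) →
                 T (ext j u′) → Step H σ′ u′ (v (suc j)) →
                 ¬ (σ ≡ σ′ × u ≡ u′) → ∀ {h} → h ∈ lists l σ → h ∉ lists l σ′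
        L-disj σ σ′ pu a pu′ a′ ≢ = lists-disj l (proj₂ (Unique-∷⁻ uI)) σ σ′
          λ { refl → ≢ (refl , trans (adj j σ j<k₁ pu a) (sym (adj j σ j<k₁ pu′ a′))) }
        module A = AddVertex {R′ = λ h → R h ⊎ h ∈ C} E (v (suc j)) (v∉ j j<k) (no-loop j j<k)
          [ inj₁ , inj₂ ∘ ∈-++⁺ʳ (w ∷ I) ]′ (fresh (here refl)) (inj₂ (here refl))
          (λ σ _ → lists l σ)
          (λ σ pu a → walk l (trans (cong (Embedding.φ E) (adj j σ j<k₁ pu a)) φj) σ (adj j σ j<k₁ pu a) a)
          (λ σ _ _ → lists-uniq l uI σ)
          (λ σ _ _ h∈ → inj₂ (∈-++⁺ˡ (there (lists⊆ l σ h∈))) , fresh (there (lists⊆ l σ h∈)))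
          L-disj

      module Close {a b C₀ I} (ch : Chain k₁ a C₀) (l : Link (kind k) a I b) (uI : Unique (b ∷ I))
        (dis : ∀ {h} → h ∈ b ∷ I → h ∉ C₀) {Q : Fin n → Set} (R⊆Q : ∀ {h} → R h → Q h)
        (G-in : ∀ {h} → h ∈ b ∷ I ++ C₀ → h ≡ x ⊎ (Q h × ¬ R h)) (x∈Q : Q x)
        {is js : List (Fin n)} (path→ : Path (Arc D) x is b) (path← : Path (Arc D) b js x)
        (uniq : Unique (x ∷ is ++ b ∷ js))
        (is-fresh : ∀ {h} → h ∈ is → (Q h × ¬ R h) × h ∉ b ∷ I ++ C₀)
        (js-fresh : ∀ {h} → h ∈ js → (Q h × ¬ R h) × h ∉ b ∷ I ++ C₀)
        where

        sides : Sign → List (Fin n)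
        sides out  = is
        sides into = js

        sides-walk : ∀ σ {x′} → x′ ≡ x → Walk D σ x′ (sides σ) b
        sides-walk out  refl = path→
        sides-walk into refl = path←

        sides-fresh : ∀ σ {h} → h ∈ sides σ → (Q h × ¬ R h) × h ∉ b ∷ I ++ C₀
        sides-fresh out  = is-fresh
        sides-fresh into = js-fresh

        parts = Unique-++⁻ is (proj₂ (Unique-∷⁻ uniq))

        sides-uniq : ∀ σ → Unique (b ∷ sides σ)
        sides-uniq out  = Unique-∷⁺ (λ b∈ → proj₂ (proj₂ parts) b∈ (here refl)) (proj₁ parts)
        sides-uniq into = proj₁ (proj₂ parts)

        sides-disj : ∀ σ σ′ → σ ≢ σ′ → ∀ {h} → h ∈ sides σ → h ∉ sides σ′
        sides-disj out  out  ≢ = contradiction refl ≢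
        sides-disj into into ≢ = contradiction refl ≢
        sides-disj out  into _ h∈ h∈′ = proj₂ (proj₂ parts) h∈ (there h∈′)
        sides-disj into out  _ h∈ h∈′ = proj₂ (proj₂ parts) h∈′ (there h∈)

        closed : Embedding H (ext k) D Q
        closed with build ℕₚ.≤-refl ch (λ h∈ → [ inj₁ , inj₂ ∘ proj₂ ]′ (G-in (there (∈-++⁺ʳ I h∈))))
        ... | E , φk₁ , φ0 = AddVertex.extended {R′ = Q} E (v k) (v∉ k₁ ℕₚ.≤-refl)
              (no-loop k₁ ℕₚ.≤-refl) old⊆ (proj₂ (fresh (here refl))) (proj₁ (fresh (here refl)))
              L L-walk L-uniq L-fresh L-disj
          where
          old⊆ : ∀ {h} → R h ⊎ h ∈ C₀ → Q h
          old⊆ (inj₁ Rh)   = R⊆Q Rh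
          old⊆ (inj₂ h∈C₀) with G-in (there (∈-++⁺ʳ I h∈C₀))
          ... | inj₁ refl     = x∈Q
          ... | inj₂ (Qh , _) = Qh
          fresh : ∀ {h} → h ∈ b ∷ I → Q h × ¬ (R h ⊎ h ∈ C₀)
          fresh h∈ with G-in (∈-++⁺ˡ h∈)
          ... | inj₁ refl        = contradiction (root∈ ch) (dis h∈)
          ... | inj₂ (Qh , ¬Rh)  = Qh , [ ¬Rh , dis h∈ ]′
          L : Sign → Fin N → List (Fin n)
          -- The last vertex has two possible earlier neighbours: the final link leads to `v k₁`,
          -- the closing paths lead to the root `v 0`.
          L σ u = if does (u ≟ v k₁) then lists l σ else sides σ
          data Source : Fin N → List (Fin n) → Sign → Set where
            from-path : ∀ {σ} → Source (v k₁) (lists l σ) σ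
            from-root : ∀ {σ} → Source (v 0) (sides σ) σ
          source : ∀ σ {u} → T (ext k₁ u) → Step H σ u (v k) → Source u (L σ u) σ
          source σ pu a with adj-last σ pu a
          ... | inj₁ refl with v k₁ ≟ v k₁
          ...   | yes _ = from-path
          ...   | no ≢  = contradiction refl ≢
          source σ pu a | inj₂ refl with v 0 ≟ v k₁
          ...   | yes eq = contradiction (sym eq) vk₁≢v₀
          ...   | no _   = from-root
          L-walk : ∀ σ {u} → T (ext k₁ u) → Step H σ u (v k) →
                   Walk D σ (Embedding.φ E u) (L σ u) b
          L-walk σ {u} pu a with L σ u | source σ pu a
          ... | _ | from-path = walk l φk₁ σ refl a
          ... | _ | from-root = sides-walk σ φ0
          L-uniq : ∀ σ {u} → T (ext k₁ u) → Step H σ u (v k) → Unique (b ∷ L σ u)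
          L-uniq σ {u} pu a with L σ u | source σ pu a
          ... | _ | from-path = lists-uniq l uI σ
          ... | _ | from-root = sides-uniq σ
          L-fresh : ∀ σ {u} → T (ext k₁ u) → Step H σ u (v k) →
                    ∀ {h} → h ∈ L σ u → Q h × ¬ (R h ⊎ h ∈ C₀)
          L-fresh σ {u} pu a h∈ with L σ u | source σ pu a
          ... | _ | from-path = fresh (there (lists⊆ l σ h∈))
          ... | _ | from-root with sides-fresh σ h∈
          ...   | (Qh , ¬Rh) , h∉G = Qh , [ ¬Rh , (λ h∈C₀ → h∉G (there (∈-++⁺ʳ I h∈C₀))) ]′
          L-disj : ∀ σ σ′ {u u′} → T (ext k₁ u) → Step H σ u (v k) →
                   T (ext k₁ u′) → Step H σ′ u′ (v k) →
                   ¬ (σ ≡ σ′ × u ≡ u′) → ∀ {h} → h ∈ L σ u → h ∉ L σ′ u′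
          L-disj σ σ′ {u} {u′} pu a pu′ a′ ≢ h∈ h∈′
            with L σ u | source σ pu a | L σ′ u′ | source σ′ pu′ a′
          ... | _ | from-path | _ | from-path =
                lists-disj l (proj₂ (Unique-∷⁻ uI)) σ σ′ (λ eq → ≢ (eq , refl)) h∈ h∈′
          ... | _ | from-root | _ | from-root = sides-disj σ σ′ (λ eq → ≢ (eq , refl)) h∈ h∈′
          ... | _ | from-path | _ | from-root =
                proj₂ (sides-fresh σ′ h∈′) (there (∈-++⁺ˡ (lists⊆ l σ h∈)))
          ... | _ | from-root | _ | from-path =
                proj₂ (sides-fresh σ h∈) (there (∈-++⁺ˡ (lists⊆ l σ′ h∈′)))

    -- Of the `k + count p₀` colours, `k` pay for the ear and the others for `p₀`. The ear runs
    -- through the reserved set, so it meets the subdivision of `p₀` only in the image of `v 0`.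
    Forced-ear : Forced H p₀ → Forced H (ext k)
    Forced-ear forced D ll q _ χ = finish (ear (φ∈R v₀∈))
      where
      open Rooted D k₁ kind s kind-last kind-sep using (module From)
      open Reserve D ll q k₁ kind s kind-last kind-sep
      open Reserved (reserve (AtLeastOn-mono (ℕₚ.≤-reflexive (sym (count-ext k ℕₚ.≤-refl))) χ))
      E₀ : Embedding H p₀ D (T ∘ q′)
      E₀ = forced D ll q′ (v 0 , v₀∈) atLeast
      open Embedding E₀ using (φ∈R)
      open Embed E₀ refl
      fresh : ∀ {h} → X h → T (q h) × ¬ T (q′ h)
      fresh Xh = X⊆ Xh , X∩q′ Xh
      finish : EarIn X (Embedding.φ E₀ (v 0)) → Embedding H (ext k) D (T ∘ q)
      finish record { chain = From.link ch l uI dis ; G-in = G-in ; path→ = path→ ; path← = path←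
                    ; uniq = uniq ; is-fresh = is-fresh ; js-fresh = js-fresh } =
        Close.closed ch l uI dis q′⊆ (λ h∈ → [ inj₁ , (λ Xh → inj₂ (fresh Xh)) ]′ (G-in h∈))
          (q′⊆ (φ∈R v₀∈)) path→ path← uniq
          (λ h∈ → fresh (proj₁ (is-fresh h∈)) , proj₂ (is-fresh h∈))
          (λ h∈ → fresh (proj₁ (js-fresh h∈)) , proj₂ (js-fresh h∈))

-- The extension step of 𝓕

Step⇒Adjacent : ∀ {n} {D : Digraph n} σ {u v} → Step D σ u v → Adjacent D u v
Step⇒Adjacent out  a = inj₁ a
Step⇒Adjacent into a = inj₂ a

kindOf-single : ∀ a b → (T a → ¬ T b) → ∃[ σ ] kindOf a b ≡ single σ
kindOf-single true  true  ¬ab = contradiction tt (¬ab tt)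
kindOf-single true  false _  = out , refl
kindOf-single false true  _  = into , refl
kindOf-single false false _  = out , refl

kindOf-double : ∀ a b → kindOf a b ≡ double → T a × T b
kindOf-double true true _ = tt , tt
kindOf-double true false ()
kindOf-double false true ()
kindOf-double false false ()

T-not : ∀ {b} → T b → ¬ T (not b)
T-not {true} _ t = t

remove : ∀ {n} → Fin n → (Fin n → Bool) → Fin n → Bool
remove v p u = p u ∧ not (does (u ≟ v))

remove⁻ : ∀ {n} {v u : Fin n} {p} → T (remove v p u) → T (p u) × u ≢ v
remove⁻ {v = v} {u} t = let (pu , u≢v) = T-diff⁻ t in pu , u≢v ∘ T-does⁺ {d = u ≟ v}

Forced-remove : ∀ {N} {H : Digraph N} {p} v → T (p v) → ¬ Arc H v v →
  (∀ {u u′} → T (p u) → u ≢ v → Adjacent H u v → T (p u′) → u′ ≢ v → Adjacent H u′ v → u ≡ u′) →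
  Forced H (remove v p) → Forced H p
Forced-remove {H = H} {p} v pv no-loop single-nbr forced = Forced-resp {p = p} add drop
    (Forced-pendant v (λ t → proj₂ (remove⁻ {p = p} t) refl) no-loop (λ {_} {_} {σ} {σ′} → nbr {σ = σ} {σ′}) forced)
  where
  nbr : ∀ {u u′ σ σ′} → T (remove v p u) → Step H σ u v → T (remove v p u′) → Step H σ′ u′ v → u ≡ u′
  nbr {σ = σ} {σ′} t a t′ a′ with remove⁻ {p = p} t | remove⁻ {p = p} t′
  ... | pu , u≢ | pu′ , u′≢ =
    single-nbr pu u≢ (Step⇒Adjacent {D = H} σ a) pu′ u′≢ (Step⇒Adjacent {D = H} σ′ a′)
  add : ∀ {u} → T (p u) → T (insert v (remove v p) u)
  add {u} pu with u ≟ v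
  ... | yes _  = tt
  ... | no u≢v = T-diff⁺ pu id
  drop : ∀ {u} → T (insert v (remove v p) u) → T (p u)
  drop {u} t with T-∨⁻ (does (u ≟ v)) t
  ... | inj₁ t′ = subst (T ∘ p) (sym (T-does⁻ {d = u ≟ v} t′)) pv
  ... | inj₂ t′ = proj₁ (remove⁻ {v = v} {p = p} t′)

count-↑ˡ : ∀ {n} m (p : Fin (n + m) → Bool) → count (p ∘ (_↑ˡ m)) ≤ count p
count-↑ˡ {zero}  m p = z≤n
count-↑ˡ {suc n} m p = ℕₚ.+-monoʳ-≤ (indicator (p zero)) (count-↑ˡ m (p ∘ suc))

∈⇒≤sum : ∀ {A : Set} (f : A → ℕ) {x xs} → x ∈ xs → f x ≤ sum (List.map f xs)
∈⇒≤sum f (here refl) = ℕₚ.m≤m+n _ _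
∈⇒≤sum f {xs = y ∷ xs} (there x∈) = ℕₚ.≤-trans (∈⇒≤sum f x∈) (ℕₚ.m≤n+m _ (f y))

T⇒1≤ : ∀ {b} → T b → 1 ≤ indicator b
T⇒1≤ {true} _ = s≤s z≤n

-- A digon would contribute `1` to the outdegree and `1` to the indegree, whose sum is `1`.
no-first-digon : ∀ {k′} {Q : Digraph (suc k′)} → Good Q → 2 ≤ suc k′ → ∀ w →
                 Arc Q zero w → ¬ Arc Q w zero
no-first-digon {Q = Q} good 2≤ w a b = contradiction (Good.degFirst good 2≤) (ℕₚ.>⇒≢ two)
  where
  two : 2 ≤ outdeg Q zero + indeg Q zero
  two = ℕₚ.+-mono-≤
    (ℕₚ.≤-trans (T⇒1≤ a) (∈⇒≤sum (λ w → indicator (arc Q zero w)) (∈-allFin w)))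
    (ℕₚ.≤-trans (T⇒1≤ b) (∈⇒≤sum (λ w → indicator (arc Q w zero)) (∈-allFin w)))

module Extension {n k′} (F : Digraph n) (v₀ : Fin n) (Q : Digraph (suc k′)) (good : Good Q)
  (dir : Bool) where

  H : Digraph (n + suc k′)
  H = extend F v₀ Q dir

  l : Fin n → Fin (n + suc k′)
  l a = a ↑ˡ suc k′

  r : Fin (suc k′) → Fin (n + suc k′)
  r i = n ↑ʳ i

  arc-ll : ∀ a b → arc H (l a) (l b) ≡ arc F a b
  arc-ll a b rewrite splitAt-↑ˡ n a (suc k′) | splitAt-↑ˡ n b (suc k′) = refl

  arc-rr : ∀ i j → arc H (r i) (r j) ≡ arc Q i j
  arc-rr i j rewrite splitAt-↑ʳ n (suc k′) i | splitAt-↑ʳ n (suc k′) j = refl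

  arc-lr : ∀ a j → arc H (l a) (r j) ≡ (a == v₀) ∧ ((j == zero) ∨ ((j == fromℕ k′) ∧ dir))
  arc-lr a j rewrite splitAt-↑ˡ n a (suc k′) | splitAt-↑ʳ n (suc k′) j = refl

  arc-rl : ∀ i b → arc H (r i) (l b) ≡ (b == v₀) ∧ ((i == zero) ∨ ((i == fromℕ k′) ∧ not dir))
  arc-rl i b rewrite splitAt-↑ʳ n (suc k′) i | splitAt-↑ˡ n b (suc k′) = refl

  data Side : Fin (n + suc k′) → Set where
    left  : ∀ a → Side (l a)
    right : ∀ i → Side (r i)

  side : ∀ u → Side u
  side u with splitAt n u | join-splitAt n (suc k′) u
  ... | inj₁ a | refl = left a
  ... | inj₂ i | refl = right i

  r-injective : ∀ {i j} → r i ≡ r j → i ≡ j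
  r-injective {i} {j} eq with refl ← trans (sym (splitAt-↑ʳ n (suc k′) i))
                                     (trans (cong (splitAt n) eq) (splitAt-↑ʳ n (suc k′) j)) = refl

  l≢r : ∀ {a i} → l a ≢ r i
  l≢r {a} {i} eq with () ← trans (sym (splitAt-↑ˡ n a (suc k′)))
                             (trans (cong (splitAt n) eq) (splitAt-↑ʳ n (suc k′) i))

  attach-ends : ∀ {a j d} → T ((a == v₀) ∧ ((j == zero) ∨ ((j == fromℕ k′) ∧ d))) →
                a ≡ v₀ × (j ≡ zero ⊎ j ≡ fromℕ k′ × T d)
  attach-ends {a} {j} {d} t with a ≟ v₀ | j ≟ zero | j ≟ fromℕ k′
  ... | yes a≡ | yes j≡ | _      = a≡ , inj₁ j≡
  ... | yes a≡ | no _   | yes j≡ = a≡ , inj₂ (j≡ , t)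

  adj-lr : ∀ {a j} → Adjacent H (l a) (r j) → a ≡ v₀ × (j ≡ zero ⊎ j ≡ fromℕ k′)
  adj-lr {a} {j} (inj₁ t) with attach-ends {a} {j} (subst T (arc-lr a j) t)
  ... | eq , inj₁ j≡       = eq , inj₁ j≡
  ... | eq , inj₂ (j≡ , _) = eq , inj₂ j≡
  adj-lr {a} {j} (inj₂ t) with attach-ends {a} {j} (subst T (arc-rl j a) t)
  ... | eq , inj₁ j≡       = eq , inj₁ j≡
  ... | eq , inj₂ (j≡ , _) = eq , inj₂ j≡

  adj-rr : ∀ {i j} → Adjacent H (r i) (r j) → toℕ j ≡ suc (toℕ i) ⊎ toℕ i ≡ suc (toℕ j)
  adj-rr {i} {j} (inj₁ t) = Good.pathArcs good i j (subst T (arc-rr i j) t)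
  adj-rr {i} {j} (inj₂ t) = [ inj₂ , inj₁ ]′ (Good.pathArcs good j i (subst T (arc-rr j i) t))

  r-loopless : ∀ i → ¬ Arc H (r i) (r i)
  r-loopless i a with adj-rr {i} {i} (inj₁ a)
  ... | inj₁ eq = ℕₚ.1+n≢n (sym eq)
  ... | inj₂ eq = ℕₚ.1+n≢n (sym eq)

  module _ (ih : ∀ p → Forced F p) where

    -- The pattern is one of `F`, so the induction hypothesis applies along `back`, which sends the
    -- absent new vertices to the arbitrary value `v₀`.
    Forced-left : ∀ p → (∀ i → ¬ T (p (r i))) → Forced H p
    Forced-left p no-right = Forced-pull back back-inj back∈ back-arc (count-↑ˡ (suc k′) p) (ih _)
      where
      back : Fin (n + suc k′) → Fin n
      back u = [ id , (λ _ → v₀) ]′ (splitAt n u)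
      back-l : ∀ a → back (l a) ≡ a
      back-l a = cong [ id , (λ _ → v₀) ]′ (splitAt-↑ˡ n a (suc k′))
      is-left : ∀ {u} → T (p u) → u ≡ l (back u)
      is-left {u} pu with side u
      ... | left a  = cong l (sym (back-l a))
      ... | right i = contradiction pu (no-right i)
      back-inj : ∀ {u w} → T (p u) → T (p w) → back u ≡ back w → u ≡ w
      back-inj pu pw eq = trans (is-left pu) (trans (cong l eq) (sym (is-left pw)))
      back∈ : ∀ {u} → T (p u) → T (p (l (back u)))
      back∈ pu = subst (T ∘ p) (is-left pu) pu
      back-arc : ∀ {u w} → T (p u) → T (p w) → Arc H u w → Arc F (back u) (back w)
      back-arc {u} {w} pu pw a =
        subst T (arc-ll (back u) (back w)) (subst T (cong₂ (arc H) (is-left pu) (is-left pw)) a)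

    module Leaf (i : Fin (suc k′)) (p : Fin (n + suc k′) → Bool)
      (nbr : ∀ {u u′} → T (p u) → Adjacent H u (r i) → T (p u′) → Adjacent H u′ (r i) → u ≡ u′)
      where

      Forced-leaf : (∀ p′ → (∀ {u} → T (p′ u) → T (p u)) → ¬ T (p′ (r i)) → Forced H p′) →
                    Forced H p
      Forced-leaf smaller with T? (p (r i))
      ... | no ¬pi = smaller p id ¬pi
      ... | yes pi = Forced-remove (r i) pi (r-loopless i) (λ pu _ a pu′ _ a′ → nbr pu a pu′ a′)
              (smaller (remove (r i) p) (proj₁ ∘ remove⁻ {v = r i} {p = p})
                       (λ t → proj₂ (remove⁻ {v = r i} {p = p} t) refl))

    one-neighbour : ∀ i (p : Fin (n + suc k′) → Bool) s →
      (∀ {j} → T (p (r j)) → Adjacent H (r j) (r i) → toℕ j ≡ s) →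
      (∀ {a j} → T (p (l a)) → Adjacent H (l a) (r i) → T (p (r j)) → ¬ Adjacent H (r j) (r i)) →
      ∀ {u u′} → T (p u) → Adjacent H u (r i) → T (p u′) → Adjacent H u′ (r i) → u ≡ u′
    one-neighbour i p s unique not-both {u} {u′} pu a pu′ a′ with side u | side u′
    ... | left _  | left _   = cong l (trans (proj₁ (adj-lr a)) (sym (proj₁ (adj-lr a′))))
    ... | left _  | right _  = contradiction a′ (not-both pu a pu′)
    ... | right _ | left _   = contradiction a (not-both pu′ a′ pu)
    ... | right _ | right _  = cong r (toℕ-injective (trans (unique pu a) (sym (unique pu′ a′))))

    -- New vertices are taken away from the top index down. The last condition excludes that `v₀`
    -- and the final vertex of `Q` are both present, so the top vertex has no neighbour left but its
    -- predecessor, or `v₀` when it is the first.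
    Forced-initial : ∀ t p → (∀ i → t ≤ toℕ i → ¬ T (p (r i))) → (¬ T (p (l v₀)) ⊎ t ≤ k′) → Forced H p
    Forced-initial zero    p absent _ = Forced-left p (λ i → absent i z≤n)
    Forced-initial (suc t) p absent open-end with t <? suc k′
    ... | no t≮ = Forced-initial t p (λ i t≤ → contradiction (ℕₚ.≤-<-trans t≤ (toℕ<n i)) t≮)
                    ([ inj₁ , inj₂ ∘ ℕₚ.<⇒≤ ]′ open-end)
    ... | yes t< = Leaf.Forced-leaf i p (one-neighbour i p (pred t) below not-both) λ p′ p′⊆ ¬p′i →
            Forced-initial t p′ (absent′ p′ p′⊆ ¬p′i) ([ (λ ¬pv → inj₁ (¬pv ∘ p′⊆)) , inj₂ ∘ ℕₚ.<⇒≤ ]′ open-end)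
      where
      i : Fin (suc k′)
      i = fromℕ< t<
      i≡t : toℕ i ≡ t
      i≡t = toℕ-fromℕ< t<
      absent′ : ∀ p′ → (∀ {u} → T (p′ u) → T (p u)) → ¬ T (p′ (r i)) →
                ∀ j → t ≤ toℕ j → ¬ T (p′ (r j))
      absent′ p′ p′⊆ ¬p′i j t≤j with ℕₚ.m≤n⇒m<n∨m≡n t≤j
      ... | inj₁ t<j = absent j t<j ∘ p′⊆
      ... | inj₂ eq  = subst (λ j → ¬ T (p′ (r j))) (toℕ-injective (trans i≡t eq)) ¬p′i
      previous : ∀ {j} → T (p (r j)) → Adjacent H (r j) (r i) → t ≡ suc (toℕ j)
      previous {j} pj a with adj-rr a
      ... | inj₁ eq = trans (sym i≡t) eq
      ... | inj₂ eq = contradiction pj (absent j (ℕₚ.≤-reflexive (trans (cong suc (sym i≡t)) (sym eq))))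
      below : ∀ {j} → T (p (r j)) → Adjacent H (r j) (r i) → toℕ j ≡ pred t
      below pj a = cong pred (sym (previous pj a))
      not-both : ∀ {a j} → T (p (l a)) → Adjacent H (l a) (r i) → T (p (r j)) →
                 ¬ Adjacent H (r j) (r i)
      not-both pa aa pj aj with adj-lr aa
      ... | a≡v₀ , inj₁ i≡0 with () ← trans (sym (previous pj aj)) (trans (sym i≡t) (cong toℕ i≡0))
      ... | a≡v₀ , inj₂ i≡k =
        [ (λ ¬pv → ¬pv (subst (T ∘ p ∘ l) a≡v₀ pa))
        , ℕₚ.<-irrefl (trans (sym i≡t) (trans (cong toℕ i≡k) (toℕ-fromℕ k′))) ]′ open-end

    -- The vertex with index `m` is missing. Those above it are taken away in increasing order, each
    -- with at most its successor, or `v₀` at the very end, as neighbour; `d` counts those not yet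
    -- treated. The part below `m` is then an initial one.
    Forced-gap : ∀ {m} → m ≤ k′ → ∀ d t → t + d ≡ suc k′ → m < t →
                 ∀ p → (∀ i → m ≤ toℕ i → toℕ i < t → ¬ T (p (r i))) → Forced H p
    Forced-gap {m} m≤k′ zero t t≡ m<t p absent = Forced-initial m p
      (λ i m≤i → absent i m≤i (subst (toℕ i <_) (sym (trans (sym (ℕₚ.+-identityʳ t)) t≡)) (toℕ<n i)))
      (inj₂ m≤k′)
    Forced-gap {m} m≤k′ (suc d) t t≡ m<t p absent =
      Leaf.Forced-leaf i p (one-neighbour i p (suc t) above not-both) λ p′ p′⊆ ¬p′i →
        Forced-gap m≤k′ d (suc t) (trans (sym (ℕₚ.+-suc t d)) t≡) (ℕₚ.m≤n⇒m≤1+n m<t) p′ (absent′ p′ p′⊆ ¬p′i)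
      where
      t< : t < suc k′
      t< = subst (t <_) t≡ (ℕₚ.m<m+n t (s≤s z≤n))
      i : Fin (suc k′)
      i = fromℕ< t<
      i≡t : toℕ i ≡ t
      i≡t = toℕ-fromℕ< t<
      absent′ : ∀ p′ → (∀ {u} → T (p′ u) → T (p u)) → ¬ T (p′ (r i)) →
                ∀ j → m ≤ toℕ j → toℕ j < suc t → ¬ T (p′ (r j))
      absent′ p′ p′⊆ ¬p′i j m≤j j≤t with ℕₚ.m≤n⇒m<n∨m≡n (s≤s⁻¹ j≤t)
      ... | inj₁ j<t = absent j m≤j j<t ∘ p′⊆
      ... | inj₂ eq  = subst (λ j → ¬ T (p′ (r j))) (toℕ-injective (trans i≡t (sym eq))) ¬p′i
      above : ∀ {j} → T (p (r j)) → Adjacent H (r j) (r i) → toℕ j ≡ suc t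
      above {j} pj a with adj-rr a
      ... | inj₂ eq = trans eq (cong suc i≡t)
      ... | inj₁ eq = contradiction pj (absent j (s≤s⁻¹ (subst (m <_) t≡j m<t)) (ℕₚ.≤-reflexive (sym t≡j)))
        where
        t≡j : t ≡ suc (toℕ j)
        t≡j = trans (sym i≡t) eq
      not-both : ∀ {a j} → T (p (l a)) → Adjacent H (l a) (r i) → T (p (r j)) →
                 ¬ Adjacent H (r j) (r i)
      not-both {j = j} _ aa pj aj with proj₂ (adj-lr aa)
      ... | inj₁ i≡0 = contradiction (subst (m <_) (trans (sym i≡t) (cong toℕ i≡0)) m<t) λ ()
      ... | inj₂ i≡k = ℕₚ.<-irrefl
            (trans (above pj aj) (cong suc (trans (sym i≡t) (trans (cong toℕ i≡k) (toℕ-fromℕ k′)))))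
            (toℕ<n j)

    module Whole (p : Fin (n + suc k′) → Bool) (root∈ : T (p (l v₀))) (all∈ : ∀ i → T (p (r i))) where

      isLeft : Fin (n + suc k′) → Bool
      isLeft u = [ (λ _ → true) , (λ _ → false) ]′ (splitAt n u)

      p₀ : Fin (n + suc k′) → Bool
      p₀ u = p u ∧ isLeft u

      p₀-left : ∀ {a} → T (p (l a)) → T (p₀ (l a))
      p₀-left {a} pa with p (l a)
      ... | true rewrite splitAt-↑ˡ n a (suc k′) = tt

      p₀-right : ∀ i → ¬ T (p₀ (r i))
      p₀-right i t with p (r i)
      ... | true rewrite splitAt-↑ʳ n (suc k′) i = t

      p₀⊆p : ∀ {u} → T (p₀ u) → T (p u)
      p₀⊆p {u} t with p u
      ... | true = tt

      position : ℕ → Fin (suc k′)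
      position i = fromℕ< (s≤s (ℕₚ.m∸n≤m k′ i))

      toℕ-position : ∀ i → toℕ (position i) ≡ k′ ∸ i
      toℕ-position i = toℕ-fromℕ< (s≤s (ℕₚ.m∸n≤m k′ i))

      -- The paper's v₀, v_k, v_{k-1}, …, v₁.
      branch : ℕ → Fin (n + suc k′)
      branch zero    = l v₀
      branch (suc i) = r (position i)

      position-injective : ∀ {i j} → i ≤ k′ → j ≤ k′ → position i ≡ position j → i ≡ j
      position-injective {i} {j} i≤ j≤ eq = ℕₚ.∸-cancelˡ-≡ i≤ j≤
        (trans (sym (toℕ-position i)) (trans (cong toℕ eq) (toℕ-position j)))

      position-onto : ∀ i → position (k′ ∸ toℕ i) ≡ i
      position-onto i = toℕ-injective
        (trans (toℕ-position (k′ ∸ toℕ i)) (ℕₚ.m∸[m∸n]≡n (s≤s⁻¹ (toℕ<n i))))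

      module WithTail (κ : ℕ) (k′≡ : k′ ≡ suc κ) where

        open EarPattern H p₀ κ branch

        ext⁻ : ∀ i {u} → T (ext i u) → T (p₀ u) ⊎ ∃[ j ] j < i × u ≡ branch (suc j)
        ext⁻ zero    t = inj₁ t
        ext⁻ (suc i) {u} t with T-∨⁻ (does (u ≟ branch (suc i))) t
        ... | inj₁ t′ = inj₂ (i , ℕₚ.≤-refl , T-does⁻ {d = u ≟ branch (suc i)} t′)
        ... | inj₂ t′ with ext⁻ i t′
        ...   | inj₁ t₀           = inj₁ t₀
        ...   | inj₂ (j , j< , eq) = inj₂ (j , ℕₚ.m≤n⇒m≤1+n j< , eq)

        ext-p₀ : ∀ i {u} → T (p₀ u) → T (ext i u)
        ext-p₀ zero    t = t
        ext-p₀ (suc i) {u} t = T-∨⁺ʳ (does (u ≟ branch (suc i))) (ext-p₀ i t)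

        ext-v : ∀ i {j} → j < i → T (ext i (branch (suc j)))
        ext-v (suc i) {j} j<i with ℕₚ.m≤n⇒m<n∨m≡n (s≤s⁻¹ j<i)
        ... | inj₂ refl = T-∨⁺ˡ (T-does⁺ {d = branch (suc i) ≟ branch (suc i)} refl)
        ... | inj₁ j<   = T-∨⁺ʳ (does (branch (suc j) ≟ branch (suc i))) (ext-v i j<)

        ≤k′ : ∀ {i} → i < k → i ≤ k′
        ≤k′ i<k = subst (_ ≤_) (sym k′≡) (s≤s⁻¹ i<k)

        k′≤ : ∀ {i} → i ≤ k′ → i < k
        k′≤ i≤ = s≤s (subst (_ ≤_) k′≡ i≤)

        v∉ : ∀ i → i < k → ¬ T (ext i (branch (suc i)))
        v∉ i i<k t with ext⁻ i t
        ... | inj₁ t₀ = p₀-right _ t₀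
        ... | inj₂ (j , j<i , eq) = ℕₚ.<-irrefl
              (sym (position-injective (≤k′ i<k) (ℕₚ.≤-trans (ℕₚ.<⇒≤ j<i) (≤k′ i<k)) (r-injective eq))) j<i

        consecutive : ∀ {i j} → j < i → i ≤ k′ → Adjacent H (branch (suc j)) (branch (suc i)) → i ≡ suc j
        consecutive {suc i} {j} (s≤s j≤i) i<k a with adj-rr a
        ... | inj₁ eq = contradiction (ℕₚ.∸-monoʳ-≤ k′ (ℕₚ.m≤n⇒m≤1+n j≤i))
                (ℕₚ.<⇒≱ (ℕₚ.≤-reflexive (trans (cong suc (sym (toℕ-position j)))
                                               (trans (sym eq) (toℕ-position (suc i))))))
        ... | inj₂ eq = cong suc (sym (ℕₚ.∸-cancelˡ-≡ (ℕₚ.≤-trans j≤i (ℕₚ.<⇒≤ i<k)) (ℕₚ.<⇒≤ i<k)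
                (trans (sym (toℕ-position j)) (trans eq
                  (trans (cong suc (toℕ-position (suc i)))
                         (trans (cong suc (sym (ℕₚ.pred[m∸n]≡m∸[1+n] k′ i))) (suc-pred′ (ℕₚ.m<n⇒0<n∸m i<k))))))))
          where
          suc-pred′ : ∀ {m} → 0 < m → suc (pred m) ≡ m
          suc-pred′ (s≤s _) = refl

        -- An old neighbour can only be `v₀`, attached at both ends of `Q`. At the end numbered
        -- first it is the predecessor `branch 0`; the other end is the exceptional case `i ≡ k′`.
        neighbours : ∀ i {u} → i ≤ k′ → T (ext i u) → Adjacent H u (branch (suc i)) →
                     u ≡ branch i ⊎ (u ≡ branch 0 × i ≡ k′)
        neighbours i {u} i≤ t a with ext⁻ i t
        ... | inj₂ (j , j<i , refl) = inj₁ (cong branch (sym (consecutive j<i i≤ a)))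
        ... | inj₁ t₀ with side u
        ...   | right j = contradiction t₀ (p₀-right j)
        ...   | left b with adj-lr a
        ...     | refl , inj₁ eq = inj₂ (refl ,
                    ℕₚ.≤-antisym i≤ (ℕₚ.m∸n≡0⇒m≤n (trans (sym (toℕ-position i)) (cong toℕ eq))))
        ...     | refl , inj₂ eq = inj₁ (cong branch (ℕₚ.∸-cancelˡ-≡ z≤n i≤
                    (trans (sym (toℕ-fromℕ k′)) (trans (cong toℕ (sym eq)) (toℕ-position i)))))

        -- There are at least two new vertices, so `branch 1` is not the digon partner of `v₀`, and
        -- `dir` selects exactly one arc.
        root-single : (T (arc H (branch 0) (branch 1)) → ¬ T (arc H (branch 1) (branch 0)))
        root-single a b
          with attach-ends {v₀} {position 0} (subst T (arc-lr v₀ (position 0)) a)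
             | attach-ends {v₀} {position 0} {not dir} (subst T (arc-rl (position 0) v₀) b)
        ... | _ , inj₁ eq | _ = contradiction (trans (sym k′≡) (trans (sym (toℕ-position 0)) (cong toℕ eq))) λ ()
        ... | _ , inj₂ _  | _ , inj₁ eq = contradiction (trans (sym k′≡) (trans (sym (toℕ-position 0)) (cong toℕ eq))) λ ()
        ... | _ , inj₂ (_ , d) | _ , inj₂ (_ , ¬d) = T-not d ¬d

        -- The tip `branch k` is the first vertex of `Q`, whose degree condition excludes a digon.
        -- This provides the single last link that chains can prolong.
        tip-single : T (arc H (branch k₁) (branch k)) → ¬ T (arc H (branch k) (branch k₁))
        tip-single a b = no-first-digon good (s≤s (subst (1 ≤_) (sym k′≡) (s≤s z≤n))) (position κ)
          (subst (λ z → Arc Q z (position κ)) last≡0 (subst T (arc-rr _ _) b))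
          (subst (λ z → Arc Q (position κ) z) last≡0 (subst T (arc-rr _ _) a))
          where
          last≡0 : position k₁ ≡ zero
          last≡0 = toℕ-injective (trans (toℕ-position k₁)
                     (trans (cong (_∸ k₁) k′≡) (ℕₚ.n∸n≡0 k₁)))

        -- Past the link at the root, which is single, two consecutive double links would be digons
        -- of `Q` with a common vertex.
        kind-sep : ∀ j → kind (suc j) ≡ double → ∃[ σ ] kind j ≡ single σ
        kind-sep zero    _ = out , refl
        kind-sep (suc zero) _ = kindOf-single _ _ root-single
        kind-sep (suc (suc i)) eq with kindOf-double _ _ eq
        ... | bc , cb = kindOf-single _ _ λ ab ba →
          let A = position i
              B = position (suc i)
              C = position (suc (suc i))
              ab′ = subst T (arc-rr A B) ab
              a≡c = Good.digonsDisjoint good A B C ab′ (subst T (arc-rr B A) ba)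
                      (subst T (arc-rr B C) bc) (subst T (arc-rr C B) cb)
          in strict i ab (trans (sym (toℕ-position i)) (trans (cong toℕ a≡c) (toℕ-position (suc (suc i)))))
          where
          -- Subtraction is truncated, so all positions past the end of the path coincide. The arc
          -- shows that `position i` is still one above its successor, hence different from the one
          -- after.
          strict : ∀ i → Arc H (branch (suc i)) (branch (suc (suc i))) → k′ ∸ i ≢ k′ ∸ suc (suc i)
          strict i ab eq′ with adj-rr {position i} {position (suc i)} (inj₁ ab)
          ... | inj₁ up = contradiction
                  (trans (sym (toℕ-position (suc i))) (trans up (cong suc (toℕ-position i))))
                  (ℕₚ.<⇒≢ (s≤s (ℕₚ.∸-monoʳ-≤ k′ (ℕₚ.n≤1+n i))))
          ... | inj₂ down = ℕₚ.<-irrefl (sym eq′) (ℕₚ.≤-<-trans (ℕₚ.∸-monoʳ-≤ k′ (ℕₚ.n≤1+n (suc i)))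
                  (ℕₚ.≤-reflexive (sym (trans (sym (toℕ-position i))
                                              (trans down (cong suc (toℕ-position (suc i))))))))

        Forced-whole : Forced H p
        Forced-whole = Forced-resp {p = p} p⊆ ⊆p
          (Forced-ear (p₀-left root∈) v∉ (λ i _ → r-loopless (position i)) adj adj-last (l≢r ∘ sym)
            (proj₁ last-kind) (proj₂ last-kind) kind-sep
            (Forced-left p₀ p₀-right))
          where
          last-kind : ∃[ σ ] kind k ≡ single σ
          last-kind = kindOf-single _ _ tip-single
          adj : ∀ i σ {u} → i < k₁ → T (ext i u) → Step H σ u (branch (suc i)) → u ≡ branch i
          adj i σ i<k₁ t a with neighbours i (≤k′ (ℕₚ.m≤n⇒m≤1+n i<k₁)) t (Step⇒Adjacent {D = H} σ a)
          ... | inj₁ eq = eq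
          ... | inj₂ (_ , i≡k′) = contradiction (trans i≡k′ k′≡) (ℕₚ.<⇒≢ i<k₁)
          adj-last : ∀ σ {u} → T (ext k₁ u) → Step H σ u (branch k) → u ≡ branch k₁ ⊎ u ≡ branch 0
          adj-last σ t a = [ inj₁ , inj₂ ∘ proj₁ ]′
            (neighbours k₁ (≤k′ ℕₚ.≤-refl) t (Step⇒Adjacent {D = H} σ a))
          ⊆p : ∀ {u} → T (ext k u) → T (p u)
          ⊆p t with ext⁻ k t
          ... | inj₁ t₀           = p₀⊆p t₀
          ... | inj₂ (j , _ , refl) = all∈ (position j)
          p⊆ : ∀ {u} → T (p u) → T (ext k u)
          p⊆ {u} pu with side u
          ... | left a  = ext-p₀ k (p₀-left pu)
          ... | right i = subst (λ i → T (ext k (r i))) (position-onto i)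
                            (ext-v k (k′≤ (ℕₚ.m∸n≤m k′ (toℕ i))))

      -- With one new vertex the ear is just the digon at `v₀`, so that vertex is pendant.
      pendant-whole : k′ ≡ 0 → Forced H p
      pendant-whole k′≡0 = Leaf.Forced-leaf zero p (one-neighbour zero p 0 (λ {j} _ _ → only j)
          (λ {_} {j} _ _ _ → r-loopless′ j)) λ p′ p′⊆ ¬p′0 →
            Forced-left p′ λ i → subst (λ i → ¬ T (p′ (r i))) (toℕ-injective (sym (only i))) ¬p′0
        where
        only : ∀ j → toℕ j ≡ 0
        only j = ℕₚ.n≤0⇒n≡0 (subst (toℕ j ≤_) k′≡0 (s≤s⁻¹ (toℕ<n j)))
        r-loopless′ : ∀ j → ¬ Adjacent H (r j) (r zero)
        r-loopless′ j a with adj-rr a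
        ... | inj₁ ()
        ... | inj₂ eq with () ← trans (sym (only j)) eq

    Forced-extend : ∀ p → Forced H p
    Forced-extend p with T? (p (l v₀)) | any? (λ i → ¬? (T? (p (r i))))
    ... | no ¬pv | _ = Forced-initial (suc k′) p (λ i k<i → contradiction (toℕ<n i) (ℕₚ.≤⇒≯ k<i)) (inj₁ ¬pv)
    ... | yes _ | yes (i , ¬pi) =
      Forced-gap (s≤s⁻¹ (toℕ<n i)) (k′ ∸ toℕ i) (suc (toℕ i))
        (cong suc (ℕₚ.m+[n∸m]≡n (s≤s⁻¹ (toℕ<n i)))) ℕₚ.≤-refl p
        λ j i≤j j≤i → subst (λ j → ¬ T (p (r j))) (toℕ-injective (ℕₚ.≤-antisym i≤j (s≤s⁻¹ j≤i))) ¬pi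
    ... | yes pv | no full = whole k′ refl
      where
      open Whole p pv (λ i → decidable-stable (T? (p (r i))) λ ¬pi → full (i , ¬pi))
      whole : ∀ m → k′ ≡ m → Forced H p
      whole zero    eq = pendant-whole eq
      whole (suc κ) eq = WithTail.Forced-whole κ eq

-- Subdigraphs and the induction over `𝓕`

image : ∀ {m n} → (Fin m → Fin n) → (Fin m → Bool) → Fin n → Bool
image f p v = does (any? λ u → T? (p u) ×-dec (f u ≟ v))

image⁺ : ∀ {m n} (f : Fin m → Fin n) p {u} → T (p u) → T (image f p (f u))
image⁺ f p {u} pu = T-does⁺ {d = any? λ w → T? (p w) ×-dec (f w ≟ f u)} (u , pu , refl)

image⁻ : ∀ {m n} (f : Fin m → Fin n) p {v} → T (image f p v) → ∃[ u ] T (p u) × f u ≡ v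
image⁻ f p {v} = T-does⁻ {d = any? λ u → T? (p u) ×-dec (f u ≟ v)}

count-empty : ∀ {n} {p : Fin n → Bool} → (∀ u → ¬ T (p u)) → count p ≡ 0
count-empty {zero}      none = refl
count-empty {suc n} {p} none with p zero | none zero
... | true  | ¬t = contradiction tt ¬t
... | false | _  = count-empty (none ∘ suc)

count-insert-≤ : ∀ {n} v (p : Fin n → Bool) → count (insert v p) ≤ suc (count p)
count-insert-≤ v p with T? (p v)
... | no ¬pv = ℕₚ.≤-reflexive (count-insert v ¬pv)
... | yes pv = ℕₚ.m≤n⇒m≤1+n (count-mono drop)
  where
  drop : ∀ u → T (insert v p u) → T (p u)
  drop u t with T-∨⁻ (does (u ≟ v)) t
  ... | inj₁ t′ = subst (T ∘ p) (sym (T-does⁻ {d = u ≟ v} t′)) pv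
  ... | inj₂ pu = pu

count-image : ∀ {m n} (f : Fin m → Fin n) p → count (image f p) ≤ count p
count-image {zero}  f p = ℕₚ.≤-reflexive (count-empty {p = image f p} λ v t → case proj₁ (image⁻ f p {v} t) of λ ())
count-image {suc m} f p with T? (p zero)
... | yes p0 = ℕₚ.≤-trans (count-mono sub⊆)
      (ℕₚ.≤-trans (count-insert-≤ (f zero) (image (f ∘ suc) (p ∘ suc)))
        (ℕₚ.+-mono-≤ (T⇒1≤ p0) (count-image (f ∘ suc) (p ∘ suc))))
  where
  sub⊆ : ∀ v → T (image f p v) → T (insert (f zero) (image (f ∘ suc) (p ∘ suc)) v)
  sub⊆ v t with image⁻ f p t
  ... | zero  , _  , refl = T-∨⁺ˡ (T-does⁺ {d = f zero ≟ f zero} refl)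
  ... | suc u , pu , refl = T-∨⁺ʳ (does (f (suc u) ≟ f zero)) (image⁺ (f ∘ suc) (p ∘ suc) pu)
... | no ¬p0 = ℕₚ.≤-trans (count-mono sub⊆)
      (ℕₚ.≤-trans (count-image (f ∘ suc) (p ∘ suc)) (ℕₚ.m≤n+m _ (indicator (p zero))))
  where
  sub⊆ : ∀ v → T (image f p v) → T (image (f ∘ suc) (p ∘ suc) v)
  sub⊆ v t with image⁻ f p t
  ... | zero  , p0 , _    = contradiction p0 ¬p0
  ... | suc u , pu , refl = image⁺ (f ∘ suc) (p ∘ suc) pu

-- A subset of a subdigraph is handled as its image in the larger digraph, which has no more
-- vertices and so needs no more colours. This is why all subsets are treated at once.
𝓕⇒Forced : ∀ {n} {F : Digraph n} → 𝓕 F → ∀ p → Forced F p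
𝓕⇒Forced base p with T? (p zero)
... | no ¬p0 = Forced-empty λ { zero → ¬p0 }
... | yes p0 = Forced-remove zero p0 (λ ()) (λ { {zero} _ 0≢0 → contradiction refl 0≢0 ; {suc ()} })
      (Forced-empty λ { zero t → proj₂ (remove⁻ {p = p} t) refl ; (suc ()) })
𝓕⇒Forced (step 𝓕F v₀ Q good dir) = Extension.Forced-extend _ v₀ Q good dir (𝓕⇒Forced 𝓕F)
𝓕⇒Forced (sub 𝓕F (f , f-inj , f-arc)) p =
  Forced-pull f (λ _ _ → f-inj) (image⁺ f p) (λ _ _ → f-arc _ _) (count-image f p)
    (𝓕⇒Forced 𝓕F (image f p))

-- The lower bound from complete digraphs

complete : ∀ m → Digraph m
complete m = mkDigraph λ u v → not (does (u ≟ v))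

complete-arc : ∀ {m} {u v : Fin m} → u ≢ v → Arc (complete m) u v
complete-arc {u = u} {v} u≢v with u ≟ v
... | yes u≡v = contradiction u≡v u≢v
... | no _    = tt

complete-loopless : ∀ m → Loopless (complete m)
complete-loopless m v t with v ≟ v
... | no v≢v = v≢v refl

-- With fewer than `m` colours two vertices share one, and the digon between them is a monochromatic
-- cycle.
complete-dichromatic : ∀ m → DichromaticAtLeast (complete m) m
complete-dichromatic m k k<m (c , acyclic) with pigeonhole k<m c
... | u , v , u<v , cu≡cv = acyclic u (v ∷ [])
      ( complete-arc u≢v ∷ complete-arc (u≢v ∘ sym) ∷ [-]
      , Unique-∷⁺ (λ { (here eq) → u≢v eq }) ([] ∷ []))
      (sym cu≡cv ∷ [])
  where
  u≢v : u ≢ v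
  u≢v refl = ℕₚ.<-irrefl refl u<v

MaderBound⇒≤ : ∀ {h} {F : Digraph h} {m} → MaderBound F m → h ≤ m
MaderBound⇒≤ {m = m} bound with bound (complete m) (complete-loopless m) (complete-dichromatic m)
... | φ , φ-inj , _ = injective⇒≤ φ-inj

-- From forced patterns to the Mader number

count-full : ∀ n → count {n} (λ _ → true) ≡ n
count-full zero    = refl
count-full (suc n) = cong suc (count-full n)

atLeastOn-all : ∀ {n} {D : Digraph n} {m} → DichromaticAtLeast D m → AtLeastOn D (λ _ → true) m
atLeastOn-all χ k k<m (c , c< , acyclic) = χ k k<m
  ( (λ v → fromℕ< (c< v tt))
  , λ x xs cyc same → acyclic (x ∷ xs) cyc (All.tabulate λ _ → tt) (c x)
      (refl ∷ All.map (λ {y} eq → trans (sym (toℕ-fromℕ< (c< y tt)))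
                                        (trans (cong toℕ eq) (toℕ-fromℕ< (c< x tt)))) same))

Forced⇒MaderBound : ∀ {n} {F : Digraph n} → Forced F (λ _ → true) → MaderBound F n
-- The constructor `sub` also yields the digraph without vertices, whose only subset is empty and so
-- outside the scope of `Forced`.
Forced⇒MaderBound {zero}  forced D ll χ =
  (λ ()) , (λ { {()} }) , (λ ()) , (λ ()) , (λ ()) , (λ ()) , λ ()
Forced⇒MaderBound {suc n} forced D ll χ =
  φ , φ-inj tt tt , (λ u v _ → P u v) ,
  (λ u v a → toLinked (P-path tt tt a)) ,
  (λ u v a → P-uniq tt tt a) ,
  (λ u v a w → P-avoid tt tt a tt) ,
  λ u v a u′ v′ a′ ≢ x → P-disj tt tt a tt tt a′ ≢
  where
  open Embedding (forced D ll (λ _ → true) (zero , tt)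
    (AtLeastOn-mono (ℕₚ.≤-reflexive (count-full (suc n))) (atLeastOn-all χ)))

theorem1p5 : ∀ {n} (F : Digraph n) → 𝓕 F → MaderIs F n
theorem1p5 F 𝓕F = Forced⇒MaderBound (𝓕⇒Forced 𝓕F (λ _ → true)) , λ m → MaderBound⇒≤
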